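{- Let $L$ be an $r\times s$ $\boldsymbol\rho$-latin rectangle with $r,s\le n$ and $n>\min\{r,s\}$. For $t\in\{r,s\}$ put $P_t=\{\ell\in[k] : \rho_\ell-e_\ell>n-t\}$ (so $P_{\min\{r,s\}}\subseteq P_{\max\{r,s\}}$), and write $\bar P_t=[k]\setminus P_t$. Call a sequence $\{(a_\ell,b_\ell)\}_{\ell=1}^k$ fitting if $a_\ell,b_\ell$ are nonnegative integers for all $\ell\in[k]$ and $$\sum_{\ell\in[k]}a_\ell=r(n-s)+|P_r|(n-r)-\sum_{\ell\in P_r}(\rho_\ell-e_\ell),$$ $$\sum_{\ell\in[k]}b_\ell=s(n-r)+|P_s|(n-s)-\sum_{\ell\in P_s}(\rho_\ell-e_\ell),$$ and for every $\ell\in[k]$: $$a_\ell+b_\ell\le\begin{cases}2n-r-s+e_\ell-\rho_\ell & \text{if } \ell\in P_{\min\{r,s\}},\\ n-\max\{r,s\} & \text{if } \ell\in P_{\max\{r,s\}}\setminus P_{\min\{r,s\}},\\ \rho_\ell-e_\ell & \text{if } \ell\in \bar P_{\max\{r,s\}}.\end{cases}$$ Then $L$ can be completed to an $n\times n$ $\boldsymbol\rho$-latin square if and only if there exists a fitting sequence $\{(a_\ell,b_\ell)\}_{\ell=1}^k$ for which one (equivalently, every) condition in the list (R1)–(R6) holds, and also one (equivalently, every) condition in the list (C1)–(C6) holds. For a fixed fitting sequence, the six conditions (R1)–(R6) are mutually equivalent, and the six conditions (C1)–(C6) are mutually equivalent. (R1) For all $I\subseteq[r]$: $$|I|(n-s)\le\sum_{\ell\in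 P_r}\min\{a_\ell+\rho_\ell-e_\ell-n+r,\ \mu_I(\ell)\}+\sum_{\ell\in\bar P_r}\min\{a_\ell,\ \mu_I(\ell)\}.$$ (R2) For all $K\subseteq[k]$: $$\sum_{\ell\in K\cap P_r}(\rho_\ell-e_\ell)\le\sum_{i\in[r]}\min\{n-s,\ \mu_K(i)\}-\sum_{\ell\in K}a_\ell+|K\cap P_r|(n-r).$$ (R3) For all $I\subseteq[r]$: $$|I|(n-s)\ge\sum_{\ell\in P_r}\big((a_\ell+\rho_\ell+\mu_I(\ell))\dot- n\big)+\sum_{\ell\in\bar P_r}\big(a_\ell\dot-\mu_{\bar I}(\ell)\big).$$ (R4) For all $K\subseteq[k]$: $$\sum_{\ell\in K\cap P_r}(\rho_\ell-e_\ell)\ge\sum_{i\in[r]}\big((n-s)\dot-\mu_{\bar K}(i)\big)+|K\cap P_r|(n-r)-\sum_{\ell\in K}a_\ell.$$ (R5) For all $I\subseteq[r]$ and $K\subseteq[k]$: $$|I|(n-s)\le\sum_{\ell\in K\cap P_r}(\rho_\ell-e_\ell)+\sum_{\ell\in K}a_\ell+\mu_I(\bar K)-|K\cap P_r|(n-r).$$ (R6) For all $I\subseteq[r]$ and $K\subseteq[k]$: $$\sum_{\ell\in K\cap P_r}(\rho_\ell-e_\ell)\le|I|(n-s)+|K\cap P_r|(n-r)+\mu_K(\bar I)-\sum_{\ell\in K}a_\ell.$$ (C1)–(C6) are obtained from (R1)–(R6), respectively, by interchanging $r$ and $s$, replacing $I\subseteq[r]$ by $J\subseteq[s]$ (with $\bar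 J=[s]\setminus J$ and column quantities $\mu_J(\ell)$, $\mu_K(j)$, $\mu_{\bar K}(j)$, $\mu_J(\bar K)$, $\mu_K(\bar J)$), replacing $P_r$ by $P_s$, and replacing $a_\ell$ by $b_\ell$. For example: (C1) For all $J\subseteq[s]$: $$|J|(n-r)\le\sum_{\ell\in P_s}\min\{b_\ell+\rho_\ell-e_\ell-n+s,\ \mu_J(\ell)\}+\sum_{\ell\in\bar P_s}\min\{b_\ell,\ \mu_J(\ell)\}.$$ (C3) For all $J\subseteq[s]$: $$|J|(n-r)\ge\sum_{\ell\in P_s}\big((b_\ell+\rho_\ell+\mu_J(\ell))\dot- n\big)+\sum_{\ell\in\bar P_s}\big(b_\ell\dot-\mu_{\bar J}(\ell)\big).$$
   Context: Let $n,k$ be positive integers. Let $\boldsymbol\rho=(\rho_1,\dots,\rho_k)$ be integers with $1\le\rho_\ell\le n\le k$ for all $\ell\in[k]=\{1,\dots,k\}$ and $\sum_{\ell\in[k]}\rho_\ell=n^2$. The symbols are the elements of $[k]$. A $\boldsymbol\rho$-latin square of order $n$ is an $n\times n$ array in which every cell contains a symbol of $[k]$, each symbol occurs at most once in each row and at most once in each column, and each symbol $\ell$ occurs exactly $\rho_\ell$ times. An $r\times s$ $\boldsymbol\rho$-latin rectangle is an $r\times s$ array in which every cell contains a symbol of $[k]$, each symbol occurs at most once in each row and at most once in each column, and each symbol $\ell$ occurs at most $\rho_\ell$ times. It can be completed to an $n\times n$ $\boldsymbol\rho$-latin square if there is a $\boldsymbol\rho$-latin square of order $n$ whose top-left $r\times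 s$ subarray equals it. For a rectangle $L$, its rows are $[r]$, its columns are $[s]$, and $e_\ell$ is the number of occurrences of symbol $\ell$ in $L$. For $i\in[r]$, $j\in[s]$, $\ell\in[k]$, $I\subseteq[r]$, $J\subseteq[s]$, $K\subseteq[k]$: - $\mu_K(i)$ is the number of symbols of $K$ not occurring in row $i$ of $L$; - $\mu_K(j)$ is the number of symbols of $K$ not occurring in column $j$ of $L$; - $\mu_I(\ell)$ is the number of rows in $I$ not containing $\ell$; - $\mu_J(\ell)$ is the number of columns in $J$ not containing $\ell$; - $\mu_K(I)=\sum_{i\in I}\mu_K(i)$, $\mu_I(K)=\sum_{\ell\in K}\mu_I(\ell)$, $\mu_K(J)=\sum_{j\in J}\mu_K(j)$, $\mu_J(K)=\sum_{\ell\in K}\mu_J(\ell)$. Complements are taken within the natural ground set: $\bar I=[r]\setminus I$, $\bar J=[s]\setminus J$, $\bar K=[k]\setminus K$. For reals $x,y$, $x\dot- y:=\max\{0,x-y\}$, and $x-y\dot- z$ means $(x-y)\dot- z$. -}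

module Defs where

open import Algebra.Properties.CommutativeMonoid.Sum using (sum)
open import Data.Bool.Base using (if_then_else_)
open import Data.Fin.Base using (Fin; inject≤)
open import Data.Fin.Patterns using (0F; 1F; 2F; 3F; 4F; 5F)
open import Data.Fin.Properties using (_≟_; any?)
open import Data.Fin.Subset using (Subset; _∩_; ∁; ∣_∣)
open import Data.Integer.Base using (ℤ; +_; 0ℤ; _+_; _-_; _*_; _⊓_; _⊔_; _≤_; _≥_)
import Data.Integer.Properties as ℤ
open import Data.Nat.Base as ℕ using (ℕ)
import Data.Nat.Properties as ℕ
open import Data.Product.Base using (Σ; _×_)
open import Data.Vec.Base using (lookup; tabulate)
open import Data.Vec.Functional using (Vector; transpose)
open import Function.Base using (_∘_)
open import Function.Definitions using (Injective)
open import Level using (0ℓ)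
open import Relation.Binary.PropositionalEquality.Core using (_≡_)
open import Relation.Nullary.Decidable using (does; ¬?)
open import Relation.Unary using (Pred; Decidable)

sumℕ : ∀ {n} → Vector ℕ n → ℕ
sumℕ = sum ℕ.+-0-commutativeMonoid

sumℤ : ∀ {n} → Vector ℤ n → ℤ
sumℤ = sum ℤ.+-0-commutativeMonoid

sumOver : ∀ {n} → Subset n → Vector ℤ n → ℤ
sumOver K f = sumℤ λ i → if lookup K i then f i else 0ℤ

infix 7 sumOver
syntax sumOver K (λ i → x) = ∑[ i ∈ K ] x

infixl 6 _∸_

_∸_ : ℤ → ℤ → ℤ
x ∸ y = 0ℤ ⊔ (x - y)

⟪_⟫ : ∀ {n} {P : Pred (Fin n) 0ℓ} → Decidable P → Subset n
⟪ P? ⟫ = tabulate (does ∘ P?)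

Array : ℕ → ℕ → ℕ → Set
Array r s k = Vector (Vector (Fin k) s) r

occurrences : ∀ {r s k} → Array r s k → Fin k → ℕ
occurrences L ℓ = sumℕ λ i → ∣ ⟪ (λ j → L i j ≟ ℓ) ⟫ ∣

record IsLatin {r s k : ℕ} (L : Array r s k) : Set where
  field
    rows    : ∀ i → Injective _≡_ _≡_ (L i)
    columns : ∀ j → Injective _≡_ _≡_ (transpose L j)

record IsLatinRectangle {r s k : ℕ} (ρ : Fin k → ℕ) (L : Array r s k) : Set where
  field
    isLatin : IsLatin L
    bounded : ∀ ℓ → occurrences L ℓ ℕ.≤ ρ ℓ

record IsLatinSquare {n k : ℕ} (ρ : Fin k → ℕ) (M : Array n n k) : Set where
  field
    isLatin : IsLatin M
    exact   : ∀ ℓ → occurrences M ℓ ≡ ρ ℓ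

Completable : ∀ {n r s k} → .(r ℕ.≤ n) → .(s ℕ.≤ n) → (Fin k → ℕ) → Array r s k → Set
Completable {n} {k = k} r≤n s≤n ρ L =
  Σ (Array n n k) λ M →
    IsLatinSquare ρ M × (∀ i j → M (inject≤ i r≤n) (inject≤ j s≤n) ≡ L i j)

absentFromRow : ∀ {r s k} → Array r s k → Fin r → Subset k
absentFromRow L i = ⟪ (λ ℓ → ¬? (any? λ j → L i j ≟ ℓ)) ⟫

rowsWithout : ∀ {r s k} → Array r s k → Fin k → Subset r
rowsWithout L ℓ = ⟪ (λ i → ¬? (any? λ j → L i j ≟ ℓ)) ⟫

-- The set P_t, for a rectangle in which symbol ℓ occurs e ℓ times.
P : ∀ {k} → ℕ → (ρ e : Fin k → ℕ) → ℕ → Subset k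
P n ρ e t = ⟪ (λ ℓ → (+ n - + t) ℤ.<? (+ ρ ℓ - + e ℓ)) ⟫

-- The conditions (R1)–(R6) for the array L.  Interchanging the roles of rows
-- and columns (and of r and s) amounts to passing to the transposed array, so
-- (C1)–(C6) are the same conditions for transpose L.  The occurrence counts e
-- are a parameter so that both families refer to the counts of L itself.
module LineConditions {r s k : ℕ} (n : ℕ) (ρ e : Fin k → ℕ)
                      (L : Array r s k) (a : Fin k → ℕ) where

  Pᵣ : Subset k
  Pᵣ = P n ρ e r

  -- μˢ K i is μ_K(i), and μˡ I ℓ is μ_I(ℓ).
  μˢ : Subset k → Fin r → ℤ
  μˢ K i = + ∣ K ∩ absentFromRow L i ∣

  μˡ : Subset r → Fin k → ℤ
  μˡ I ℓ = + ∣ I ∩ rowsWithout L ℓ ∣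

  Cond₁ Cond₂ Cond₃ Cond₄ Cond₅ Cond₆ : Set

  Cond₁ = ∀ (I : Subset r) →
    + ∣ I ∣ * (+ n - + s)
      ≤ ∑[ ℓ ∈ Pᵣ ] ((+ a ℓ + + ρ ℓ - + e ℓ - + n + + r) ⊓ μˡ I ℓ)
        + ∑[ ℓ ∈ ∁ Pᵣ ] (+ a ℓ ⊓ μˡ I ℓ)

  Cond₂ = ∀ (K : Subset k) →
    ∑[ ℓ ∈ K ∩ Pᵣ ] (+ ρ ℓ - + e ℓ)
      ≤ sumℤ (λ i → (+ n - + s) ⊓ μˢ K i)
        - ∑[ ℓ ∈ K ] (+ a ℓ)
        + + ∣ K ∩ Pᵣ ∣ * (+ n - + r)

  Cond₃ = ∀ (I : Subset r) →
    + ∣ I ∣ * (+ n - + s)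
      ≥ ∑[ ℓ ∈ Pᵣ ] ((+ a ℓ + + ρ ℓ + μˡ I ℓ) ∸ + n)
        + ∑[ ℓ ∈ ∁ Pᵣ ] (+ a ℓ ∸ μˡ (∁ I) ℓ)

  Cond₄ = ∀ (K : Subset k) →
    ∑[ ℓ ∈ K ∩ Pᵣ ] (+ ρ ℓ - + e ℓ)
      ≥ sumℤ (λ i → (+ n - + s) ∸ μˢ (∁ K) i)
        + + ∣ K ∩ Pᵣ ∣ * (+ n - + r)
        - ∑[ ℓ ∈ K ] (+ a ℓ)

  Cond₅ = ∀ (I : Subset r) (K : Subset k) →
    + ∣ I ∣ * (+ n - + s)
      ≤ ∑[ ℓ ∈ K ∩ Pᵣ ] (+ ρ ℓ - + e ℓ)
        + ∑[ ℓ ∈ K ] (+ a ℓ)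
        + ∑[ ℓ ∈ ∁ K ] (μˡ I ℓ)
        - + ∣ K ∩ Pᵣ ∣ * (+ n - + r)

  Cond₆ = ∀ (I : Subset r) (K : Subset k) →
    ∑[ ℓ ∈ K ∩ Pᵣ ] (+ ρ ℓ - + e ℓ)
      ≤ + ∣ I ∣ * (+ n - + s)
        + + ∣ K ∩ Pᵣ ∣ * (+ n - + r)
        + ∑[ i ∈ ∁ I ] (μˢ K i)
        - ∑[ ℓ ∈ K ] (+ a ℓ)

  condition : Fin 6 → Set
  condition 0F = Cond₁
  condition 1F = Cond₂
  condition 2F = Cond₃
  condition 3F = Cond₄
  condition 4F = Cond₅
  condition 5F = Cond₆

R : ∀ {r s k} → ℕ → (Fin k → ℕ) → Array r s k → (Fin k → ℕ) → Fin 6 → Set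
R n ρ L a = LineConditions.condition n ρ (occurrences L) L a

C : ∀ {r s k} → ℕ → (Fin k → ℕ) → Array r s k → (Fin k → ℕ) → Fin 6 → Set
C n ρ L b = LineConditions.condition n ρ (occurrences L) (transpose L) b

record IsFitting {r s k : ℕ} (n : ℕ) (ρ : Fin k → ℕ) (L : Array r s k)
                 (a b : Fin k → ℕ) : Set where
  e : Fin k → ℕ
  e = occurrences L

  Pₜ : ℕ → Subset k
  Pₜ = P n ρ e

  bound : Fin k → ℤ
  bound ℓ =
    if lookup (Pₜ (r ℕ.⊓ s)) ℓ then + 2 * + n - + r - + s + + e ℓ - + ρ ℓ
    else if lookup (Pₜ (r ℕ.⊔ s)) ℓ then + n - + (r ℕ.⊔ s)
    else + ρ ℓ - + e ℓ

  field
    sum-a : + sumℕ a ≡ + r * (+ n - + s) + + ∣ Pₜ r ∣ * (+ n - + r)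
                         - ∑[ ℓ ∈ Pₜ r ] (+ ρ ℓ - + e ℓ)
    sum-b : + sumℕ b ≡ + s * (+ n - + r) + + ∣ Pₜ s ∣ * (+ n - + s)
                         - ∑[ ℓ ∈ Pₜ s ] (+ ρ ℓ - + e ℓ)
    a+b≤  : ∀ ℓ → + a ℓ + + b ℓ ≤ bound ℓ

-- Write x_ℓ, y_ℓ and z_ℓ for the numbers of copies of ℓ to be placed to the right of L, below L and
-- in the remaining corner.  The n − r new rows hold y_ℓ + z_ℓ ≤ n − r copies, so x_ℓ is at least the
-- excess of ρ_ℓ − e_ℓ over n − r, and a_ℓ is the surplus of x_ℓ over that; likewise b_ℓ for y_ℓ.
-- "Fitting" then says that x and y have the right totals and that x_ℓ + y_ℓ ≤ ρ_ℓ − e_ℓ.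
--
-- Let H be the bipartite graph joining row i to the symbols absent from it.  Each of (R1)–(R6) is
-- Ore's cut condition for H to have a subgraph with degree n − s at every row and x_ℓ at every
-- symbol ℓ: the forms with a minimum or a truncated difference arise by choosing the best I or K,
-- the others by complementation.  Ore's theorem is proved by uncrossing violated cuts.
--
-- Given such subgraphs for rows and columns, merge the new rows into one row of weight n − r and the
-- new columns into one column of weight n − s, with z_ℓ edges in the corner.  Since y_ℓ + z_ℓ ≤ n − r
-- and x_ℓ + z_ℓ ≤ n − s, König-type edge colourings split the merged row and then the merged column.

module Submission where

open import Defs

-- Given the two subgraphs, nothing is left to choose in the corner: `z_ℓ` must be
-- `ρ_ℓ - e_ℓ - x_ℓ - y_ℓ`, and its total is `(n - r)(n - s)` because the `ρ_ℓ` add up to `n²`.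
-- Hence the row problem and the column problem meet only in `x_ℓ + y_ℓ ≤ ρ_ℓ - e_ℓ`.
--
-- The edge colourings come from Ore's theorem again. If the degrees of a bipartite multigraph are
-- all multiples of `N`, dividing every multiplicity by `N` gives a fractional solution with the
-- quotients as degrees; so all cut conditions hold, and Ore's theorem supplies an integral colour
-- class. This is why Ore's theorem is stated for capacities although the graph `H` is simple. It is
-- also stated for two degree sequences with equal totals: this balance is what allows `I` and `K`
-- to be exchanged for their complements, both in the induction's base case and among the six
-- conditions.

module _ where
  import Algebra.Properties.Semiring.Sum as SemiringSum
  open import Data.Bool.Base using (Bool; true; false; not; _∧_; _∨_; if_then_else_)
  open import Data.Bool.Properties using (not-involutive; if-float)
  open import Data.Fin.Base using (Fin; zero; suc; inject≤; splitAt; _↑ˡ_; _↑ʳ_)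
  open import Data.Fin.Patterns using (0F; 1F; 2F; 3F; 4F; 5F)
  open import Data.Fin.Properties using (_≟_; any?; join-splitAt; toℕ-injective; toℕ-inject≤; toℕ-↑ˡ)
  open import Data.Fin.Subset using (Subset; _∩_; _∪_; ∁; ∣_∣; ⊥)
  open import Data.Fin.Subset.Properties using (anySubset?)
  open import Data.Integer.Base as ℤ
    using (ℤ; +_; 0ℤ; 1ℤ; -1ℤ; _+_; _-_; -_; _*_; _⊓_; _⊔_; _≤_; _<_; +≤+)
  import Data.Integer.Properties as ℤ
  open import Data.Integer.Tactic.RingSolver using (solve-∀)
  open import Data.Nat.Base as ℕ using (ℕ; zero; suc; z≤n; s≤s)
  import Data.Nat.Properties as ℕ
  import Data.Nat.Tactic.RingSolver as ℕ-Ring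
  open import Data.Product.Base using (Σ; ∃; ∃₂; _×_; _,_; proj₁; proj₂)
  open import Data.Sum.Base using (_⊎_; inj₁; inj₂)
  open import Data.Vec.Base using (lookup; tabulate; []; _∷_)
  open import Data.Vec.Functional using (Vector; transpose; _++_)
  open import Data.Vec.Functional.Properties using (lookup-++ˡ; lookup-++ʳ)
  open import Data.Vec.Properties using (lookup∘tabulate; lookup-zipWith; lookup-map; lookup-replicate)
  open import Function.Base using (_∘_; _$_; case_of_)
  open import Function.Bundles using (_⇔_; mk⇔; Equivalence)
  open import Function.Construct.Composition using () renaming (_⇔-∘_ to infixr 8 _⇔-∘_)
  open import Function.Construct.Symmetry using (⇔-sym)
  open import Relation.Binary.PropositionalEquality
    using (_≡_; refl; sym; trans; cong; cong₂; subst; subst₂; module ≡-Reasoning)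
  open import Relation.Nullary using (Dec; yes; no; ¬_; contradiction; does)
  open import Relation.Nullary.Decidable using (True; toWitness)

  -- Sums and indicator functions

  module ℤΣ = SemiringSum ℤ.+-*-semiring
  module ℕΣ = SemiringSum ℕ.+-*-semiring

  -- Inequalities are carried over by comparing differences, which leaves an identity for the ring
  -- solver.
  ≤-from-difference : ∀ {x y x′ y′} → y - x ≡ y′ - x′ → x ≤ y → x′ ≤ y′
  ≤-from-difference eq x≤y = ℤ.0≤i-j⇒j≤i (subst (0ℤ ≤_) eq (ℤ.i≤j⇒0≤j-i x≤y))

  sum-mono : ∀ {n} {f g : Vector ℤ n} → (∀ i → f i ≤ g i) → sumℤ f ≤ sumℤ g
  sum-mono {zero}  f≤g = ℤ.≤-refl
  sum-mono {suc n} f≤g = ℤ.+-mono-≤ (f≤g zero) (sum-mono (f≤g ∘ suc))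

  sum-0 : ∀ {n} {f : Vector ℤ n} → (∀ i → f i ≡ 0ℤ) → sumℤ f ≡ 0ℤ
  sum-0 {n} f≡0 = trans (ℤΣ.sum-cong-≗ f≡0) (ℤΣ.sum-replicate-zero n)

  sum-neg : ∀ {n} (f : Vector ℤ n) → sumℤ (λ i → - f i) ≡ - sumℤ f
  sum-neg {zero}  f = refl
  sum-neg {suc n} f =
    trans (cong (_+_ (- f zero)) (sum-neg (f ∘ suc))) (sym (ℤ.neg-distrib-+ (f zero) _))

  sum-minus : ∀ {n} (f g : Vector ℤ n) → sumℤ (λ i → f i - g i) ≡ sumℤ f - sumℤ g
  sum-minus f g = trans (ℤΣ.∑-distrib-+ f (λ i → - g i)) (cong (_+_ (sumℤ f)) (sum-neg g))

  sum-const : ∀ n (c : ℤ) → sumℤ {n} (λ _ → c) ≡ + n * c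
  sum-const zero    c = sym (ℤ.*-zeroˡ c)
  sum-const (suc n) c = trans (cong (_+_ c) (sum-const n c)) (sym (ℤ.suc-* (+ n) c))

  pos-sum : ∀ {n} (f : Vector ℕ n) → + sumℕ f ≡ sumℤ (λ i → + f i)
  pos-sum {zero}  f = refl
  pos-sum {suc n} f = trans (ℤ.pos-+ (f zero) _) (cong (_+_ (+ f zero)) (pos-sum (f ∘ suc)))

  sum-↑ : ∀ r {p} (f : Vector ℕ (r ℕ.+ p)) →
    sumℕ f ≡ sumℕ (λ i → f (i ↑ˡ p)) ℕ.+ sumℕ (λ i → f (r ↑ʳ i))
  sum-↑ zero    f = refl
  sum-↑ (suc r) f =
    trans (cong (ℕ._+_ (f zero)) (sum-↑ r (f ∘ suc))) (sym (ℕ.+-assoc (f zero) _ _))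

  -- Integer-valued, so that identities between subsets become ring identities.
  χ : Bool → ℤ
  χ b = if b then 1ℤ else 0ℤ

  χ-not : ∀ b → χ (not b) ≡ 1ℤ - χ b
  χ-not true  = refl
  χ-not false = refl

  χ-∧ : ∀ a b → χ (a ∧ b) ≡ χ a * χ b
  χ-∧ true  b = sym (ℤ.*-identityˡ (χ b))
  χ-∧ false b = sym (ℤ.*-zeroˡ (χ b))

  if-χ : ∀ b x → (if b then x else 0ℤ) ≡ χ b * x
  if-χ true  x = sym (ℤ.*-identityˡ x)
  if-χ false x = sym (ℤ.*-zeroˡ x)

  ⟦_⟧ : ∀ {n} → Subset n → Fin n → ℤ
  ⟦ K ⟧ i = χ (lookup K i)

  ⟦∁⟧ : ∀ {n} (K : Subset n) i → ⟦ ∁ K ⟧ i ≡ 1ℤ - ⟦ K ⟧ i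
  ⟦∁⟧ K i = trans (cong χ (lookup-map i not K)) (χ-not (lookup K i))

  ⟦∩⟧ : ∀ {n} (K K′ : Subset n) i → ⟦ K ∩ K′ ⟧ i ≡ ⟦ K ⟧ i * ⟦ K′ ⟧ i
  ⟦∩⟧ K K′ i = trans (cong χ (lookup-zipWith _∧_ i K K′)) (χ-∧ (lookup K i) (lookup K′ i))

  sumOver-⟦⟧ : ∀ {n} (K : Subset n) f → sumOver K f ≡ sumℤ (λ i → ⟦ K ⟧ i * f i)
  sumOver-⟦⟧ K f = ℤΣ.sum-cong-≗ λ i → if-χ (lookup K i) (f i)

  ∣∣-⟦⟧ : ∀ {n} (K : Subset n) → + ∣ K ∣ ≡ sumℤ ⟦ K ⟧
  ∣∣-⟦⟧ []          = refl
  ∣∣-⟦⟧ (true ∷ K)  = trans (ℤ.pos-+ 1 ∣ K ∣) (cong (_+_ 1ℤ) (∣∣-⟦⟧ K))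
  ∣∣-⟦⟧ (false ∷ K) = trans (∣∣-⟦⟧ K) (sym (ℤ.+-identityˡ _))

  δ : ∀ {n} → Fin n → Fin n → ℕ
  δ i j = if does (i ≟ j) then 1 else 0

  δ-refl : ∀ {n} (i : Fin n) → δ i i ≡ 1
  δ-refl i with i ≟ i
  ... | yes _  = refl
  ... | no i≢i = contradiction refl i≢i

  δ-suc : ∀ {n} (i j : Fin n) → δ (suc i) (suc j) ≡ δ i j
  δ-suc i j with i ≟ j
  ... | yes _ = refl
  ... | no  _ = refl

  sum-δ : ∀ {n} (i : Fin n) (f : Vector ℤ n) → sumℤ (λ j → f j * + δ i j) ≡ f i
  sum-δ {suc n} zero f = begin
    f zero * 1ℤ + sumℤ (λ j → f (suc j) * 0ℤ)
      ≡⟨ cong₂ _+_ (ℤ.*-identityʳ (f zero)) (sum-0 λ j → ℤ.*-zeroʳ (f (suc j))) ⟩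
    f zero + 0ℤ
      ≡⟨ ℤ.+-identityʳ (f zero) ⟩
    f zero
      ∎
    where open ≡-Reasoning
  sum-δ {suc n} (suc i) f = begin
    f zero * 0ℤ + sumℤ (λ j → f (suc j) * + δ (suc i) (suc j))
      ≡⟨ cong₂ _+_ (ℤ.*-zeroʳ (f zero)) (ℤΣ.sum-cong-≗ λ j → cong (λ n → f (suc j) * + n) (δ-suc i j)) ⟩
    0ℤ + sumℤ (λ j → f (suc j) * + δ i j)
      ≡⟨ ℤ.+-identityˡ _ ⟩
    sumℤ (λ j → f (suc j) * + δ i j)
      ≡⟨ sum-δ i (f ∘ suc) ⟩
    f (suc i)
      ∎
    where
    open ≡-Reasoning

  -- Uncrossing of cuts and Ore's theorem

  ∀𝔹? : {Q : Bool → Set} → (∀ b → Dec (Q b)) → Dec (∀ b → Q b)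
  ∀𝔹? Q? with Q? true | Q? false
  ... | yes t | yes f = yes λ { true → t ; false → f }
  ... | no ¬t | _     = no λ q → ¬t (q true)
  ... | _     | no ¬f = no λ q → ¬f (q false)

  -- Proof by evaluation: the implicit argument is the decision over all sixteen cases.
  boolean-≤ : {f g : Bool → Bool → Bool → Bool → ℤ} →
    {True (∀𝔹? λ a → ∀𝔹? λ b → ∀𝔹? λ c → ∀𝔹? λ d → f a b c d ℤ.≤? g a b c d)} →
    ∀ a b c d → f a b c d ≤ g a b c d
  boolean-≤ {_} {_} {t} = toWitness t

  uncrossing : ∀ a b c d →
    χ (a ∧ b) * (1ℤ - χ (c ∧ d)) + χ (a ∨ b) * (1ℤ - χ (c ∨ d))
      ≤ χ a * (1ℤ - χ c) + χ b * (1ℤ - χ d)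
  uncrossing = boolean-≤

  -- Here `a`, `b` tell whether a row lies in two row sets and `c`, `d` whether a symbol lies in two
  -- symbol sets. A unit of capacity between them adds to the two uncrossed cuts at most 1 more than
  -- `χ b - χ d`, the change of slack caused by using that unit.
  exchange : ∀ a b c d →
    χ (a ∧ b) * (1ℤ - χ (c ∧ d)) + χ (a ∨ b) * (1ℤ - χ (c ∨ d)) + χ d ≤ 1ℤ + χ b
  exchange = boolean-≤

  χ-modular : ∀ a b → χ (a ∧ b) + χ (a ∨ b) ≡ χ a + χ b
  χ-modular true  b = ℤ.+-comm (χ b) 1ℤ
  χ-modular false b = refl

  Matrix : ℕ → ℕ → Set
  Matrix m k = Fin m → Fin k → ℕ

  -- The bilinear form of `c`: cuts, weighted row and column sums and the total differ only in `u`
  -- and `v`.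
  pairing : ∀ {m k} → (Fin m → ℤ) → (Fin k → ℤ) → Matrix m k → ℤ
  pairing u v c = sumℤ λ i → sumℤ λ ℓ → u i * v ℓ * + c i ℓ

  weight : ∀ {n} → Subset n → (Fin n → ℤ) → ℤ
  weight K x = sumℤ λ i → ⟦ K ⟧ i * x i

  cut : ∀ {m k} → Matrix m k → Subset m → Subset k → ℤ
  cut c I K = pairing ⟦ I ⟧ (λ ℓ → 1ℤ - ⟦ K ⟧ ℓ) c

  -- In the network from a source through rows and symbols to a sink, this is the capacity of the
  -- cut whose source side contains `I` and `K`, minus the total of `d`.
  slack : ∀ {m k} → Matrix m k → (Fin m → ℤ) → (Fin k → ℤ) → Subset m → Subset k → ℤ
  slack c d x I K = weight K x + cut c I K - weight I d

  Feasible : ∀ {m k} → Matrix m k → (Fin m → ℤ) → (Fin k → ℤ) → Set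
  Feasible c d x = ∀ I K → 0ℤ ≤ slack c d x I K

  weight-modular : ∀ {n} (K M : Subset n) x →
    weight (K ∩ M) x + weight (K ∪ M) x ≡ weight K x + weight M x
  weight-modular K M x = begin
    weight (K ∩ M) x + weight (K ∪ M) x                        ≡⟨ ℤΣ.∑-distrib-+ (λ i → ⟦ K ∩ M ⟧ i * x i) _ ⟨
    sumℤ (λ i → ⟦ K ∩ M ⟧ i * x i + ⟦ K ∪ M ⟧ i * x i)         ≡⟨ ℤΣ.sum-cong-≗ pointwise ⟩
    sumℤ (λ i → ⟦ K ⟧ i * x i + ⟦ M ⟧ i * x i)                 ≡⟨ ℤΣ.∑-distrib-+ (λ i → ⟦ K ⟧ i * x i) _ ⟩
    weight K x + weight M x                                    ∎
    where
    open ≡-Reasoning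
    pointwise : ∀ i → ⟦ K ∩ M ⟧ i * x i + ⟦ K ∪ M ⟧ i * x i ≡ ⟦ K ⟧ i * x i + ⟦ M ⟧ i * x i
    pointwise i rewrite lookup-zipWith _∧_ i K M | lookup-zipWith _∨_ i K M =
      trans (sym (ℤ.*-distribʳ-+ (x i) (χ (lookup K i ∧ lookup M i)) _))
        (trans (cong (_* x i) (χ-modular (lookup K i) (lookup M i)))
          (ℤ.*-distribʳ-+ (x i) (⟦ K ⟧ i) _))

  weight-∁ : ∀ {n} (K : Subset n) x → weight (∁ K) x ≡ sumℤ x - weight K x
  weight-∁ K x = trans
    (ℤΣ.sum-cong-≗ λ i → trans (cong (_* x i) (⟦∁⟧ K i)) (expand (⟦ K ⟧ i) (x i)))
    (sum-minus x _)
    where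
    expand : ∀ a b → (1ℤ - a) * b ≡ b - a * b
    expand = solve-∀

  weight-⊥ : ∀ {n} (x : Fin n → ℤ) → weight ⊥ x ≡ 0ℤ
  weight-⊥ x = sum-0 λ i → trans (cong (λ b → χ b * x i) (lookup-replicate i false)) (ℤ.*-zeroˡ (x i))

  pairing-+ : ∀ {m k} (u u′ : Fin m → ℤ) (v v′ : Fin k → ℤ) c →
    sumℤ (λ i → sumℤ λ ℓ → (u i * v ℓ + u′ i * v′ ℓ) * + c i ℓ) ≡ pairing u v c + pairing u′ v′ c
  pairing-+ u u′ v v′ c = trans
    (ℤΣ.sum-cong-≗ λ i → trans
      (ℤΣ.sum-cong-≗ λ ℓ → ℤ.*-distribʳ-+ (+ c i ℓ) (u i * v ℓ) (u′ i * v′ ℓ))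
      (ℤΣ.∑-distrib-+ (λ ℓ → u i * v ℓ * + c i ℓ) _))
    (ℤΣ.∑-distrib-+ (λ i → sumℤ λ ℓ → u i * v ℓ * + c i ℓ) _)

  -- `uncrossing` holds at each pair of a row and a symbol, and capacities are nonnegative. Since
  -- `weight` is modular, the slack inherits the inequality.
  cut-submodular : ∀ {m k} (c : Matrix m k) I J K M →
    cut c (I ∩ J) (K ∩ M) + cut c (I ∪ J) (K ∪ M) ≤ cut c I K + cut c J M
  cut-submodular c I J K M = subst₂ _≤_
    (pairing-+ ⟦ I ∩ J ⟧ ⟦ I ∪ J ⟧ _ _ c) (pairing-+ ⟦ I ⟧ ⟦ J ⟧ _ _ c)
    (sum-mono λ i → sum-mono λ ℓ → ℤ.*-monoʳ-≤-nonNeg (+ c i ℓ) (pointwise i ℓ))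
    where
    pointwise : ∀ i ℓ →
      ⟦ I ∩ J ⟧ i * (1ℤ - ⟦ K ∩ M ⟧ ℓ) + ⟦ I ∪ J ⟧ i * (1ℤ - ⟦ K ∪ M ⟧ ℓ)
        ≤ ⟦ I ⟧ i * (1ℤ - ⟦ K ⟧ ℓ) + ⟦ J ⟧ i * (1ℤ - ⟦ M ⟧ ℓ)
    pointwise i ℓ
      rewrite lookup-zipWith _∧_ i I J | lookup-zipWith _∨_ i I J
            | lookup-zipWith _∧_ ℓ K M | lookup-zipWith _∨_ ℓ K M
      = uncrossing (lookup I i) (lookup J i) (lookup K ℓ) (lookup M ℓ)

  slack-submodular : ∀ {m k} (c : Matrix m k) d x I J K M →
    slack c d x (I ∩ J) (K ∩ M) + slack c d x (I ∪ J) (K ∪ M) ≤ slack c d x I K + slack c d x J M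
  slack-submodular c d x I J K M = ≤-from-difference
    (trans (regroup (cut c (I ∩ J) (K ∩ M)) (cut c (I ∪ J) (K ∪ M)) (cut c I K) (cut c J M)
             (weight K x) (weight M x) (weight I d) (weight J d))
      (trans (cong₂ (λ X D → (slack c d x I K + slack c d x J M)
                             - ((X - D) + (cut c (I ∩ J) (K ∩ M) + cut c (I ∪ J) (K ∪ M))))
                    (sym (weight-modular K M x)) (sym (weight-modular I J d)))
        (cong (_-_ (slack c d x I K + slack c d x J M))
          (ungroup (cut c (I ∩ J) (K ∩ M)) (cut c (I ∪ J) (K ∪ M))
            (weight (K ∩ M) x) (weight (K ∪ M) x) (weight (I ∩ J) d) (weight (I ∪ J) d)))))
    (cut-submodular c I J K M)
    where
    regroup : ∀ c∩ c∪ cI cJ xK xM dI dJ →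
      (cI + cJ) - (c∩ + c∪)
        ≡ ((xK + cI - dI) + (xM + cJ - dJ)) - (((xK + xM) - (dI + dJ)) + (c∩ + c∪))
    regroup = solve-∀
    ungroup : ∀ c∩ c∪ x∩ x∪ d∩ d∪ →
      ((x∩ + x∪) - (d∩ + d∪)) + (c∩ + c∪) ≡ (x∩ + c∩ - d∩) + (x∪ + c∪ - d∪)
    ungroup = solve-∀

  weight-δ : ∀ {n} (K : Subset n) x i₀ →
    weight K (λ i → x i - + δ i₀ i) ≡ weight K x - ⟦ K ⟧ i₀
  weight-δ K x i₀ = begin
    weight K (λ i → x i - + δ i₀ i)
      ≡⟨ ℤΣ.sum-cong-≗ (λ i → expand (⟦ K ⟧ i) (x i) (+ δ i₀ i)) ⟩
    sumℤ (λ i → ⟦ K ⟧ i * x i - ⟦ K ⟧ i * + δ i₀ i)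
      ≡⟨ sum-minus (λ i → ⟦ K ⟧ i * x i) _ ⟩
    weight K x - sumℤ (λ i → ⟦ K ⟧ i * + δ i₀ i)
      ≡⟨ cong (_-_ (weight K x)) (sum-δ i₀ ⟦ K ⟧) ⟩
    weight K x - ⟦ K ⟧ i₀
      ∎
    where
    open ≡-Reasoning
    expand : ∀ a b c → a * (b - c) ≡ a * b - a * c
    expand = solve-∀

  pairing-δ : ∀ {m k} (u : Fin m → ℤ) (v : Fin k → ℤ) (c : Matrix m k) i₀ ℓ₀ →
    pairing u v (λ i ℓ → c i ℓ ℕ.+ δ i₀ i ℕ.* δ ℓ₀ ℓ) ≡ pairing u v c + u i₀ * v ℓ₀
  pairing-δ u v c i₀ ℓ₀ = begin
    pairing u v (λ i ℓ → c i ℓ ℕ.+ δ i₀ i ℕ.* δ ℓ₀ ℓ)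
      ≡⟨ ℤΣ.sum-cong-≗ row ⟩
    sumℤ (λ i → sumℤ (λ ℓ → u i * v ℓ * + c i ℓ) + u i * v ℓ₀ * + δ i₀ i)
      ≡⟨ ℤΣ.∑-distrib-+ (λ i → sumℤ (λ ℓ → u i * v ℓ * + c i ℓ)) _ ⟩
    pairing u v c + sumℤ (λ i → u i * v ℓ₀ * + δ i₀ i)
      ≡⟨ cong (_+_ (pairing u v c)) (sum-δ i₀ λ i → u i * v ℓ₀) ⟩
    pairing u v c + u i₀ * v ℓ₀
      ∎
    where
    open ≡-Reasoning
    expand : ∀ a b c d e → a * b * (c + d * e) ≡ a * b * c + a * d * b * e
    expand = solve-∀
    swap : ∀ a b c → a * b * c ≡ a * c * b
    swap = solve-∀
    entry : ∀ i ℓ → u i * v ℓ * + (c i ℓ ℕ.+ δ i₀ i ℕ.* δ ℓ₀ ℓ)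
                  ≡ u i * v ℓ * + c i ℓ + u i * + δ i₀ i * v ℓ * + δ ℓ₀ ℓ
    entry i ℓ = trans
      (cong (u i * v ℓ *_) (trans (ℤ.pos-+ (c i ℓ) _) (cong (_+_ (+ c i ℓ)) (ℤ.pos-* (δ i₀ i) _))))
      (expand (u i) (v ℓ) (+ c i ℓ) (+ δ i₀ i) (+ δ ℓ₀ ℓ))
    row : ∀ i → sumℤ (λ ℓ → u i * v ℓ * + (c i ℓ ℕ.+ δ i₀ i ℕ.* δ ℓ₀ ℓ))
              ≡ sumℤ (λ ℓ → u i * v ℓ * + c i ℓ) + u i * v ℓ₀ * + δ i₀ i
    row i = trans (ℤΣ.sum-cong-≗ (entry i))
      (trans (ℤΣ.∑-distrib-+ (λ ℓ → u i * v ℓ * + c i ℓ) _)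
        (cong (_+_ (sumℤ λ ℓ → u i * v ℓ * + c i ℓ))
          (trans (sum-δ ℓ₀ λ ℓ → u i * + δ i₀ i * v ℓ) (swap (u i) (+ δ i₀ i) (v ℓ₀)))))

  pairing-cong : ∀ {m k} (u : Fin m → ℤ) (v : Fin k → ℤ) {c c′ : Matrix m k} →
    (∀ i ℓ → c i ℓ ≡ c′ i ℓ) → pairing u v c ≡ pairing u v c′
  pairing-cong u v c≡c′ = ℤΣ.sum-cong-≗ λ i → ℤΣ.sum-cong-≗ λ ℓ →
    cong (λ n → u i * v ℓ * + n) (c≡c′ i ℓ)

  weight-singleton : ∀ {n} (x : Fin n → ℤ) i → weight ⟪ i ≟_ ⟫ x ≡ x i
  weight-singleton x i = trans (ℤΣ.sum-cong-≗ pointwise) (sum-δ i x)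
    where
    pointwise : ∀ j → ⟦ ⟪ i ≟_ ⟫ ⟧ j * x j ≡ x j * + δ i j
    pointwise j rewrite lookup∘tabulate (does ∘ (i ≟_)) j with i ≟ j
    ... | yes _ = ℤ.*-comm 1ℤ (x j)
    ... | no  _ = ℤ.*-comm 0ℤ (x j)

  -- The degrees are integers so that one can be subtracted in the induction without a positivity
  -- check; feasibility excludes negative values in the end.
  Routing : ∀ {m k} → Matrix m k → (Fin m → ℤ) → (Fin k → ℤ) → Set
  Routing {m} {k} c d x = Σ (Matrix m k) λ f →
    (∀ i ℓ → f i ℓ ℕ.≤ c i ℓ)
    × (∀ i → sumℤ (λ ℓ → + f i ℓ) ≡ d i)
    × (∀ ℓ → sumℤ (λ i → + f i ℓ) ≡ x ℓ)

  slack-δ : ∀ {m k} (c : Matrix m k) d x i₀ ℓ₀ I K →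
    slack c (λ i → d i - + δ i₀ i) (λ ℓ → x ℓ - + δ ℓ₀ ℓ) I K
      ≡ slack c d x I K - ⟦ K ⟧ ℓ₀ + ⟦ I ⟧ i₀
  slack-δ c d x i₀ ℓ₀ I K = trans
    (cong₂ (λ X D → X + cut c I K - D) (weight-δ K x ℓ₀) (weight-δ I d i₀))
    (regroup (weight K x) (⟦ K ⟧ ℓ₀) (cut c I K) (weight I d) (⟦ I ⟧ i₀))
    where
    regroup : ∀ X k C D i → X - k + C - (D - i) ≡ X + C - D - k + i
    regroup = solve-∀

  sum-minus-δ : ∀ {n} (x : Fin n → ℤ) i₀ → sumℤ (λ i → x i - + δ i₀ i) ≡ sumℤ x - 1ℤ
  sum-minus-δ x i₀ = trans (sum-minus x _) (cong (_-_ (sumℤ x))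
    (trans (ℤΣ.sum-cong-≗ λ i → sym (ℤ.*-identityˡ (+ δ i₀ i))) (sum-δ i₀ λ _ → 1ℤ)))

  -- If deleting and using the unit i₀ℓ₀ of capacity both destroy feasibility, then the two violated
  -- cuts uncross to a cut violated with that unit present.
  delete-or-use : ∀ {m k} (c c′ : Matrix m k) d x i₀ ℓ₀ →
    (∀ i ℓ → c i ℓ ≡ c′ i ℓ ℕ.+ δ i₀ i ℕ.* δ ℓ₀ ℓ) → Feasible c d x →
    Feasible c′ d x ⊎ Feasible c′ (λ i → d i - + δ i₀ i) (λ ℓ → x ℓ - + δ ℓ₀ ℓ)
  delete-or-use {m} {k} c c′ d x i₀ ℓ₀ c≡ feasible = go (violated? d x) (violated? d′ x′)
    where
    d′ = λ i → d i - + δ i₀ i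
    x′ = λ ℓ → x ℓ - + δ ℓ₀ ℓ

    Violated : (Fin m → ℤ) → (Fin k → ℤ) → Set
    Violated d x = ∃ λ I → ∃ λ K → slack c′ d x I K < 0ℤ

    violated? : ∀ d x → Dec (Violated d x)
    -- A finite search for a violated cut makes the case distinction constructive.
    violated? d x = anySubset? λ I → anySubset? λ K → slack c′ d x I K ℤ.<? 0ℤ

    intact : ∀ {d x} → ¬ Violated d x → Feasible c′ d x
    intact ¬v I K = ℤ.≮⇒≥ λ s<0 → ¬v (I , K , s<0)

    unit : Subset m → Subset k → ℤ
    unit I K = ⟦ I ⟧ i₀ * (1ℤ - ⟦ K ⟧ ℓ₀)

    slack-unit : ∀ I K → slack c d x I K ≡ slack c′ d x I K + unit I K
    slack-unit I K = trans
      (cong (λ C → weight K x + C - weight I d) (trans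
        (pairing-cong ⟦ I ⟧ _ c≡) (pairing-δ ⟦ I ⟧ _ c′ i₀ ℓ₀)))
      (regroup (weight K x) (cut c′ I K) (unit I K) (weight I d))
      where
      regroup : ∀ X C t D → X + (C + t) - D ≡ X + C - D + t
      regroup = solve-∀

    crossing : ∀ I K J M → slack c′ d x I K < 0ℤ → slack c′ d′ x′ J M < 0ℤ → 0ℤ ≤ -1ℤ
    crossing I K J M s₁<0 s₂<0 = begin
      0ℤ
        ≤⟨ ℤ.+-mono-≤ (feasible (I ∩ J) (K ∩ M)) (feasible (I ∪ J) (K ∪ M)) ⟩
      slack c d x (I ∩ J) (K ∩ M) + slack c d x (I ∪ J) (K ∪ M)
        ≡⟨ cong₂ _+_ (slack-unit (I ∩ J) (K ∩ M)) (slack-unit (I ∪ J) (K ∪ M)) ⟩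
      slack c′ d x (I ∩ J) (K ∩ M) + unit (I ∩ J) (K ∩ M)
        + (slack c′ d x (I ∪ J) (K ∪ M) + unit (I ∪ J) (K ∪ M))
        ≡⟨ regroup (slack c′ d x (I ∩ J) (K ∩ M)) (unit (I ∩ J) (K ∩ M))
                   (slack c′ d x (I ∪ J) (K ∪ M)) (unit (I ∪ J) (K ∪ M)) ⟩
      slack c′ d x (I ∩ J) (K ∩ M) + slack c′ d x (I ∪ J) (K ∪ M)
        + (unit (I ∩ J) (K ∩ M) + unit (I ∪ J) (K ∪ M))
        ≤⟨ ℤ.+-monoˡ-≤ _ (slack-submodular c′ d x I J K M) ⟩
      slack c′ d x I K + slack c′ d x J M + (unit (I ∩ J) (K ∩ M) + unit (I ∪ J) (K ∪ M))
        ≡⟨ shift (slack c′ d x I K) (slack c′ d x J M) (⟦ M ⟧ ℓ₀) (⟦ J ⟧ i₀) _ ⟩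
      slack c′ d x I K + (slack c′ d x J M - ⟦ M ⟧ ℓ₀ + ⟦ J ⟧ i₀)
        + (unit (I ∩ J) (K ∩ M) + unit (I ∪ J) (K ∪ M) + ⟦ M ⟧ ℓ₀ - ⟦ J ⟧ i₀)
        ≡⟨ cong (λ s → slack c′ d x I K + s
                     + (unit (I ∩ J) (K ∩ M) + unit (I ∪ J) (K ∪ M) + ⟦ M ⟧ ℓ₀ - ⟦ J ⟧ i₀))
                (slack-δ c′ d x i₀ ℓ₀ J M) ⟨
      slack c′ d x I K + slack c′ d′ x′ J M
        + (unit (I ∩ J) (K ∩ M) + unit (I ∪ J) (K ∪ M) + ⟦ M ⟧ ℓ₀ - ⟦ J ⟧ i₀)
        -- By integrality each violated cut has slack at most -1, and the unit gives back at most 1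
        -- of these two, by `exchange`.
        ≤⟨ ℤ.+-mono-≤ (ℤ.+-mono-≤ (ℤ.i<j⇒i≤pred[j] s₁<0) (ℤ.i<j⇒i≤pred[j] s₂<0)) units ⟩
      -1ℤ
        ∎
      where
      open ℤ.≤-Reasoning
      regroup : ∀ a b c d → a + b + (c + d) ≡ a + c + (b + d)
      regroup = solve-∀
      shift : ∀ a b m j t → a + b + t ≡ a + (b - m + j) + (t + m - j)
      shift = solve-∀
      bits : unit (I ∩ J) (K ∩ M) + unit (I ∪ J) (K ∪ M) + ⟦ M ⟧ ℓ₀ ≤ 1ℤ + ⟦ J ⟧ i₀
      bits
        rewrite lookup-zipWith _∧_ i₀ I J | lookup-zipWith _∨_ i₀ I J
              | lookup-zipWith _∧_ ℓ₀ K M | lookup-zipWith _∨_ ℓ₀ K M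
        = exchange (lookup I i₀) (lookup J i₀) (lookup K ℓ₀) (lookup M ℓ₀)
      units : unit (I ∩ J) (K ∩ M) + unit (I ∪ J) (K ∪ M) + ⟦ M ⟧ ℓ₀ - ⟦ J ⟧ i₀ ≤ 1ℤ
      units = ≤-from-difference (assoc 1ℤ (⟦ J ⟧ i₀) _) bits
        where
        assoc : ∀ a j t → a + j - t ≡ a - (t - j)
        assoc = solve-∀

    go : Dec (Violated d x) → Dec (Violated d′ x′) → Feasible c′ d x ⊎ Feasible c′ d′ x′
    go (no ¬v) _       = inj₁ (intact ¬v)
    go (yes _) (no ¬v) = inj₂ (intact ¬v)
    go (yes (I , K , s₁<0)) (yes (J , M , s₂<0)) = case crossing I K J M s₁<0 s₂<0 of λ ()

  -- Without capacity, feasibility bounds the `d`-weight of every `I` by the `x`-weight of every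
  -- `K`. For the complements, balance turns this into the reverse bound. Comparing singletons with
  -- the empty set then makes every degree 0.
  zero-routing : ∀ {m k} (c : Matrix m k) d x → (∀ i ℓ → c i ℓ ≡ 0) →
    sumℤ d ≡ sumℤ x → Feasible c d x → Routing c d x
  zero-routing {m} {k} c d x c≡0 Σd≡Σx feasible =
      (λ _ _ → 0) , (λ _ _ → z≤n)
    , (λ i → trans (ℤΣ.sum-replicate-zero k)
        (trans (sym (weight-⊥ x)) (trans (sym (balanced ⟪ i ≟_ ⟫ ⊥)) (weight-singleton d i))))
    , (λ ℓ → trans (ℤΣ.sum-replicate-zero m)
        (trans (sym (weight-⊥ d)) (trans (balanced ⊥ ⟪ ℓ ≟_ ⟫) (weight-singleton x ℓ))))
    where
    uncut : ∀ I K → weight I d ≤ weight K x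
    uncut I K = subst (weight I d ≤_)
      (trans (cong (_+_ (weight K x)) (sum-0 λ i → sum-0 λ ℓ → trans
          (cong (λ n → ⟦ I ⟧ i * (1ℤ - ⟦ K ⟧ ℓ) * + n) (c≡0 i ℓ))
          (ℤ.*-zeroʳ (⟦ I ⟧ i * (1ℤ - ⟦ K ⟧ ℓ)))))
        (ℤ.+-identityʳ (weight K x)))
      (ℤ.0≤i-j⇒j≤i (feasible I K))
    balanced : ∀ I K → weight I d ≡ weight K x
    balanced I K = ℤ.≤-antisym (uncut I K)
      (≤-from-difference
        (trans (cong₂ _-_ (weight-∁ K x) (weight-∁ I d))
          (trans (cong (λ X → X - weight K x - (sumℤ d - weight I d)) (sym Σd≡Σx))
            (cancel (sumℤ d) (weight K x) (weight I d))))
        (uncut (∁ I) (∁ K)))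
      where
      cancel : ∀ s a b → s - a - (s - b) ≡ b - a
      cancel = solve-∀

  total : ∀ {m k} → Matrix m k → ℤ
  total = pairing (λ _ → 1ℤ) (λ _ → 1ℤ)

  0≤total : ∀ {m k} (c : Matrix m k) → 0ℤ ≤ total c
  0≤total {m} {k} c =
    subst (_≤ total c) (sum-0 {m} λ _ → sum-0 {k} λ _ → refl)
      (sum-mono λ i → sum-mono λ ℓ → ℤ.*-monoˡ-≤-nonNeg 1ℤ (+≤+ (z≤n {c i ℓ})))

  -- Ore's theorem on subgraphs with prescribed degrees, for capacities; N counts the capacity left.
  ore′ : ∀ N {m k} (c : Matrix m k) d x → total c ≡ + N →
    sumℤ d ≡ sumℤ x → Feasible c d x → Routing c d x
  ore′ N c d x Σc≡N Σd≡Σx feasible with any? (λ i → any? λ ℓ → 1 ℕ.≤? c i ℓ)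
  ... | no c≡0 = zero-routing c d x
    (λ i ℓ → ℕ.n<1⇒n≡0 (ℕ.≰⇒> λ 1≤c → c≡0 (i , ℓ , 1≤c))) Σd≡Σx feasible
  ... | yes (i₀ , ℓ₀ , 1≤c) = step N (trans (sym total-unit) Σc≡N)
    where
    unit : Matrix _ _
    unit i ℓ = δ i₀ i ℕ.* δ ℓ₀ ℓ
    unit≤c : ∀ i ℓ → unit i ℓ ℕ.≤ c i ℓ
    unit≤c i ℓ with i₀ ≟ i | ℓ₀ ≟ ℓ
    ... | yes refl | yes refl = 1≤c
    ... | yes refl | no _     = z≤n
    ... | no _     | _        = z≤n
    c′ = λ i ℓ → c i ℓ ℕ.∸ unit i ℓ
    c≡ : ∀ i ℓ → c i ℓ ≡ c′ i ℓ ℕ.+ unit i ℓ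
    c≡ i ℓ = sym (ℕ.m∸n+n≡m (unit≤c i ℓ))
    total-unit : total c ≡ total c′ + 1ℤ
    total-unit = trans (pairing-cong (λ _ → 1ℤ) (λ _ → 1ℤ) c≡) (pairing-δ (λ _ → 1ℤ) (λ _ → 1ℤ) c′ i₀ ℓ₀)
    sum-row : ∀ {n} (f : Fin n → ℕ) j₀ b →
      sumℤ (λ j → + (f j ℕ.+ b ℕ.* δ j₀ j)) ≡ sumℤ (λ j → + f j) + + b
    sum-row f j₀ b = trans
      (ℤΣ.sum-cong-≗ λ j → trans (ℤ.pos-+ (f j) _) (cong (_+_ (+ f j)) (ℤ.pos-* b _)))
      (trans (ℤΣ.∑-distrib-+ (λ j → + f j) _) (cong (_+_ (sumℤ λ j → + f j)) (sum-δ j₀ λ _ → + b)))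
    restore : ∀ {y z b : ℤ} → y ≡ z - b → y + b ≡ z
    restore {z = z} {b} refl = trans (ℤ.+-assoc z (- b) b)
      (trans (cong (_+_ z) (ℤ.+-inverseˡ b)) (ℤ.+-identityʳ z))
    predecessor : ∀ {N} → total c′ + 1ℤ ≡ + suc N → total c′ ≡ + N
    predecessor {N} eq = trans (undo (total c′)) (cong (_- 1ℤ) eq)
      where
      undo : ∀ y → y ≡ y + 1ℤ - 1ℤ
      undo = solve-∀
    step : ∀ N → total c′ + 1ℤ ≡ + N → Routing c d x
    step zero Σc′+1≡0 = case subst (1ℤ ≤_) Σc′+1≡0 (ℤ.+-monoˡ-≤ 1ℤ (0≤total c′)) of λ { (+≤+ ()) }
    step (suc N) Σc′+1≡N with delete-or-use c c′ d x i₀ ℓ₀ c≡ feasible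
    ... | inj₁ feasible′ = delete (ore′ N c′ d x (predecessor Σc′+1≡N) Σd≡Σx feasible′)
      where
      delete : Routing c′ d x → Routing c d x
      delete (f , f≤c′ , rows , columns) =
        f , (λ i ℓ → ℕ.≤-trans (f≤c′ i ℓ) (ℕ.m∸n≤m (c i ℓ) (unit i ℓ))) , rows , columns
    ... | inj₂ feasible′ = use (ore′ N c′ d′ x′ (predecessor Σc′+1≡N) Σd′≡Σx′ feasible′)
      where
      d′ = λ i → d i - + δ i₀ i
      x′ = λ ℓ → x ℓ - + δ ℓ₀ ℓ
      Σd′≡Σx′ : sumℤ d′ ≡ sumℤ x′
      Σd′≡Σx′ = trans (sum-minus-δ d i₀) (trans (cong (_- 1ℤ) Σd≡Σx) (sym (sum-minus-δ x ℓ₀)))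
      use : Routing c′ d′ x′ → Routing c d x
      use (f , f≤c′ , rows , columns) =
          (λ i ℓ → f i ℓ ℕ.+ unit i ℓ)
        , (λ i ℓ → subst (f i ℓ ℕ.+ unit i ℓ ℕ.≤_) (sym (c≡ i ℓ)) (ℕ.+-monoˡ-≤ _ (f≤c′ i ℓ)))
        , (λ i → trans (sum-row (f i) ℓ₀ (δ i₀ i)) (restore (rows i)))
        , (λ ℓ → trans
            (ℤΣ.sum-cong-≗ λ i → cong (λ t → + (f i ℓ ℕ.+ t)) (ℕ.*-comm (δ i₀ i) (δ ℓ₀ ℓ)))
            (trans (sum-row (λ i → f i ℓ) i₀ (δ ℓ₀ ℓ)) (restore (columns ℓ))))

  ore : ∀ {m k} (c : Matrix m k) d x → sumℤ d ≡ sumℤ x → Feasible c d x → Routing c d x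
  ore c d x = ore′ ℤ.∣ total c ∣ c d x (sym (ℤ.0≤i⇒+∣i∣≡i (0≤total c)))

  -- Edge colourings of bipartite multigraphs

  sum-nonneg : ∀ {n} {f : Vector ℤ n} → (∀ i → 0ℤ ≤ f i) → 0ℤ ≤ sumℤ f
  sum-nonneg {zero}  0≤f = ℤ.≤-refl
  sum-nonneg {suc n} 0≤f = ℤ.+-mono-≤ (0≤f zero) (sum-nonneg (0≤f ∘ suc))

  sum-constℕ : ∀ n c → sumℕ {n} (λ _ → c) ≡ c ℕ.* n
  sum-constℕ zero    c = sym (ℕ.*-zeroʳ c)
  sum-constℕ (suc n) c = trans (cong (ℕ._+_ c) (sum-constℕ n c)) (sym (ℕ.*-suc c n))

  pairing-transpose : ∀ {m k} (u : Fin m → ℤ) (v : Fin k → ℤ) (c : Matrix m k) →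
    pairing u v c ≡ pairing v u (transpose c)
  pairing-transpose u v c = trans (ℤΣ.∑-comm λ i ℓ → u i * v ℓ * + c i ℓ)
    (ℤΣ.sum-cong-≗ λ ℓ → ℤΣ.sum-cong-≗ λ i → cong (_* + c i ℓ) (ℤ.*-comm (u i) (v ℓ)))

  pairing-rows : ∀ {m k} (u : Fin m → ℤ) (c : Matrix m k) N (w : Fin m → ℕ) →
    (∀ i → sumℕ (c i) ≡ N ℕ.* w i) →
    pairing u (λ _ → 1ℤ) c ≡ + N * sumℤ (λ i → u i * + w i)
  pairing-rows u c N w rows = trans (ℤΣ.sum-cong-≗ row) (sym (ℤΣ.*-distribˡ-sum (+ N) λ i → u i * + w i))
    where
    open ≡-Reasoning
    swap : ∀ a b c → a * (b * c) ≡ b * (a * c)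
    swap = solve-∀
    row : ∀ i → sumℤ (λ ℓ → u i * 1ℤ * + c i ℓ) ≡ + N * (u i * + w i)
    row i = begin
      sumℤ (λ ℓ → u i * 1ℤ * + c i ℓ)  ≡⟨ ℤΣ.*-distribˡ-sum (u i * 1ℤ) (λ ℓ → + c i ℓ) ⟨
      u i * 1ℤ * sumℤ (λ ℓ → + c i ℓ)  ≡⟨ cong₂ _*_ (ℤ.*-identityʳ (u i)) (sym (pos-sum (c i))) ⟩
      u i * + sumℕ (c i)               ≡⟨ cong (λ n → u i * + n) (rows i) ⟩
      u i * + (N ℕ.* w i)              ≡⟨ cong (u i *_) (ℤ.pos-* N (w i)) ⟩
      u i * (+ N * + w i)              ≡⟨ swap (u i) (+ N) (+ w i) ⟩
      + N * (u i * + w i)              ∎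

  pairing-columns : ∀ {m k} (v : Fin k → ℤ) (c : Matrix m k) N (x : Fin k → ℕ) →
    (∀ ℓ → sumℕ (λ i → c i ℓ) ≡ N ℕ.* x ℓ) →
    pairing (λ _ → 1ℤ) v c ≡ + N * sumℤ (λ ℓ → v ℓ * + x ℓ)
  pairing-columns v c N x columns =
    trans (pairing-transpose (λ _ → 1ℤ) v c) (pairing-rows v (transpose c) N x columns)

  -- The fractional solution `c / suc N`, with denominators cleared: capacity leaving `I` ends in
  -- `K` or crosses the cut, so `D ≤ X + Γ`, and `Γ` is at most `suc N` times itself.
  uniform-feasible : ∀ N {m k} (c : Matrix m k) (w : Fin m → ℕ) (x : Fin k → ℕ) →
    (∀ i → sumℕ (c i) ≡ suc N ℕ.* w i) → (∀ ℓ → sumℕ (λ i → c i ℓ) ≡ suc N ℕ.* x ℓ) →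
    Feasible c (λ i → + w i) (λ ℓ → + x ℓ)
  uniform-feasible N c w x rows columns I K = ℤ.*-cancelˡ-≤-pos 0ℤ (slack c _ _ I K) (+ suc N) (begin
    + suc N * 0ℤ
      ≡⟨ ℤ.*-zeroʳ (+ suc N) ⟩
    0ℤ
      ≤⟨ ℤ.i≤j⇒0≤j-i covered ⟩
    X + (Γ + + N * Γ) - D
      ≡⟨ cong₂ (λ X D → X + (Γ + + N * Γ) - D)
           (pairing-columns ⟦ K ⟧ c (suc N) x columns) (pairing-rows ⟦ I ⟧ c (suc N) w rows) ⟩
    + suc N * weight K (λ ℓ → + x ℓ) + (Γ + + N * Γ) - + suc N * weight I (λ i → + w i)
      ≡⟨ regroup (+ N) (weight K λ ℓ → + x ℓ) Γ (weight I λ i → + w i) ⟩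
    + suc N * slack c (λ i → + w i) (λ ℓ → + x ℓ) I K
      ∎)
    where
    open ℤ.≤-Reasoning
    X = pairing (λ _ → 1ℤ) ⟦ K ⟧ c
    Γ = cut c I K
    D = pairing ⟦ I ⟧ (λ _ → 1ℤ) c
    0≤Γ : 0ℤ ≤ Γ
    0≤Γ = sum-nonneg λ i → sum-nonneg λ ℓ → ℤ.*-monoʳ-≤-nonNeg (+ c i ℓ) (bits (lookup I i) (lookup K ℓ))
      where
      bits : ∀ a b → 0ℤ ≤ χ a * (1ℤ - χ b)
      bits true  true  = +≤+ z≤n
      bits true  false = +≤+ z≤n
      bits false b     = ℤ.≤-reflexive (sym (ℤ.*-zeroˡ (1ℤ - χ b)))
    covered : D ≤ X + (Γ + + N * Γ)
    covered = begin
      D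
        ≤⟨ sum-mono (λ i → sum-mono λ ℓ → ℤ.*-monoʳ-≤-nonNeg (+ c i ℓ) (bits (lookup I i) (lookup K ℓ))) ⟩
      sumℤ (λ i → sumℤ λ ℓ → (1ℤ * ⟦ K ⟧ ℓ + ⟦ I ⟧ i * (1ℤ - ⟦ K ⟧ ℓ)) * + c i ℓ)
        ≡⟨ pairing-+ (λ _ → 1ℤ) ⟦ I ⟧ ⟦ K ⟧ _ c ⟩
      X + Γ
        ≡⟨ cong (_+_ X) (ℤ.+-identityʳ Γ) ⟨
      X + (Γ + 0ℤ)
        ≤⟨ ℤ.+-monoʳ-≤ X (ℤ.+-monoʳ-≤ Γ
             (subst (_≤ + N * Γ) (ℤ.*-zeroʳ (+ N)) (ℤ.*-monoˡ-≤-nonNeg (+ N) 0≤Γ))) ⟩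
      X + (Γ + + N * Γ)
        ∎
      where
      bits : ∀ a b → χ a * 1ℤ ≤ 1ℤ * χ b + χ a * (1ℤ - χ b)
      bits true  true  = +≤+ (s≤s z≤n)
      bits true  false = +≤+ (s≤s z≤n)
      bits false true  = +≤+ z≤n
      bits false false = +≤+ z≤n
    regroup : ∀ n x c d → (1ℤ + n) * x + (c + n * c) - (1ℤ + n) * d ≡ (1ℤ + n) * (x + c - d)
    regroup = solve-∀

  term≤sum : ∀ {n} (f : Vector ℕ n) i → f i ℕ.≤ sumℕ f
  term≤sum f zero    = ℕ.m≤m+n (f zero) _
  term≤sum f (suc i) = ℕ.≤-trans (term≤sum (f ∘ suc) i) (ℕ.m≤n+m _ (f zero))

  sum≡0 : ∀ {n} {f : Vector ℕ n} → sumℕ f ≡ 0 → ∀ i → f i ≡ 0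
  sum≡0 {f = f} Σf≡0 i = ℕ.n≤0⇒n≡0 (subst (f i ℕ.≤_) Σf≡0 (term≤sum f i))

  sum-ℤ⇒ℕ : ∀ {n} (f : Vector ℕ n) {a} → sumℤ (λ i → + f i) ≡ + a → sumℕ f ≡ a
  sum-ℤ⇒ℕ f eq = ℤ.+-injective (trans (pos-sum f) eq)

  sum-∸ : ∀ {n} (f g : Vector ℕ n) {a b} → (∀ i → g i ℕ.≤ f i) → sumℕ f ≡ b ℕ.+ a → sumℕ g ≡ b →
    sumℕ (λ i → f i ℕ.∸ g i) ≡ a
  sum-∸ f g {a} {b} g≤f Σf≡ Σg≡b = ℕ.+-cancelʳ-≡ b _ a (begin
    sumℕ (λ i → f i ℕ.∸ g i) ℕ.+ b        ≡⟨ cong (ℕ._+_ _) Σg≡b ⟨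
    sumℕ (λ i → f i ℕ.∸ g i) ℕ.+ sumℕ g   ≡⟨ ℕΣ.∑-distrib-+ (λ i → f i ℕ.∸ g i) g ⟨
    sumℕ (λ i → f i ℕ.∸ g i ℕ.+ g i)      ≡⟨ ℕΣ.sum-cong-≗ (λ i → ℕ.m∸n+n≡m (g≤f i)) ⟩
    sumℕ f                                ≡⟨ Σf≡ ⟩
    b ℕ.+ a                               ≡⟨ ℕ.+-comm b a ⟩
    a ℕ.+ b                               ∎)
    where open ≡-Reasoning

  Decomposition : ∀ N {m k} → Matrix m k → (Fin m → ℕ) → (Fin k → ℕ) → Set
  Decomposition N {m} {k} c w x = Σ (Fin N → Matrix m k) λ f →
    (∀ t i → sumℕ (f t i) ≡ w i)
    × (∀ t ℓ → sumℕ (λ i → f t i ℓ) ≡ x ℓ)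
    × (∀ i ℓ → sumℕ (λ t → f t i ℓ) ≡ c i ℓ)

  -- One routing with degrees `w` and `x` is removed at a time; the remaining sums are again
  -- uniform, with one colour fewer. For unit degrees this is König's theorem on regular bipartite
  -- multigraphs.
  decompose : ∀ N {m k} (c : Matrix m k) (w : Fin m → ℕ) (x : Fin k → ℕ) →
    (∀ i → sumℕ (c i) ≡ N ℕ.* w i) → (∀ ℓ → sumℕ (λ i → c i ℓ) ≡ N ℕ.* x ℓ) →
    Decomposition N c w x
  decompose zero c w x rows columns = (λ ()) , (λ ()) , (λ ()) , λ i ℓ → sym (sum≡0 (rows i) ℓ)
  decompose (suc N) {m} {k} c w x rows columns =
    extend (ore c (λ i → + w i) (λ ℓ → + x ℓ) Σw≡Σx (uniform-feasible N c w x rows columns))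
    where
    scaled : + suc N * sumℤ (λ i → 1ℤ * + w i) ≡ + suc N * sumℤ (λ ℓ → 1ℤ * + x ℓ)
    scaled = trans (sym (pairing-rows (λ _ → 1ℤ) c (suc N) w rows))
      (pairing-columns (λ _ → 1ℤ) c (suc N) x columns)

    Σw≡Σx : sumℤ (λ i → + w i) ≡ sumℤ (λ ℓ → + x ℓ)
    Σw≡Σx = trans (ℤΣ.sum-cong-≗ λ i → sym (ℤ.*-identityˡ (+ w i)))
      (trans (ℤ.*-cancelˡ-≡ (+ suc N) _ _ scaled) (ℤΣ.sum-cong-≗ λ ℓ → ℤ.*-identityˡ (+ x ℓ)))

    extend : Routing c (λ i → + w i) (λ ℓ → + x ℓ) → Decomposition (suc N) c w x
    extend (f₀ , f₀≤c , rows₀ , columns₀) = prepend (decompose N (λ i ℓ → c i ℓ ℕ.∸ f₀ i ℓ) w x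
      (λ i → sum-∸ (c i) (f₀ i) (f₀≤c i) (rows i) (sum-ℤ⇒ℕ (f₀ i) (rows₀ i)))
      (λ ℓ → sum-∸ (λ i → c i ℓ) (λ i → f₀ i ℓ) (λ i → f₀≤c i ℓ) (columns ℓ)
        (sum-ℤ⇒ℕ (λ i → f₀ i ℓ) (columns₀ ℓ))))
      where
      prepend : Decomposition N (λ i ℓ → c i ℓ ℕ.∸ f₀ i ℓ) w x → Decomposition (suc N) c w x
      prepend (f , rowsᶠ , columnsᶠ , sumᶠ) =
          (λ { zero → f₀ ; (suc t) → f t })
        , (λ { zero i → sum-ℤ⇒ℕ (f₀ i) (rows₀ i) ; (suc t) i → rowsᶠ t i })
        , (λ { zero ℓ → sum-ℤ⇒ℕ (λ i → f₀ i ℓ) (columns₀ ℓ) ; (suc t) ℓ → columnsᶠ t ℓ })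
        , λ i ℓ → trans (cong (ℕ._+_ (f₀ i ℓ)) (sumᶠ i ℓ)) (ℕ.m+[n∸m]≡n (f₀≤c i ℓ))

  -- A dummy row brings every column sum up to N, so that decompose applies.
  split : ∀ N {m k} (c : Matrix m k) (w : Fin m → ℕ) →
    (∀ i → sumℕ (c i) ≡ N ℕ.* w i) → (∀ ℓ → sumℕ (λ i → c i ℓ) ℕ.≤ N) →
    Σ (Fin N → Matrix m k) λ f →
      (∀ t i → sumℕ (f t i) ≡ w i)
      × (∀ t ℓ → sumℕ (λ i → f t i ℓ) ℕ.≤ 1)
      × (∀ i ℓ → sumℕ (λ t → f t i ℓ) ≡ c i ℓ)
  split N {m} {k} c w rows columns with decompose N c₀ w₀ (λ _ → 1) rows₀ columns₀
    where
    col : Fin k → ℕ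
    col ℓ = sumℕ λ i → c i ℓ
    c₀ : Matrix (suc m) k
    c₀ zero    ℓ = N ℕ.∸ col ℓ
    c₀ (suc i) ℓ = c i ℓ
    w₀ : Fin (suc m) → ℕ
    -- The deficits `N ∸ col ℓ` add up to `N * k ∸ N * sumℕ w`, which is `N` times this weight;
    -- truncated subtraction distributes over the product, also for `N = 0`.
    w₀ zero    = k ℕ.∸ sumℕ w
    w₀ (suc i) = w i
    open ≡-Reasoning
    Σcol : sumℕ col ≡ N ℕ.* sumℕ w
    Σcol = trans (ℕΣ.∑-comm λ ℓ i → c i ℓ) (trans (ℕΣ.sum-cong-≗ rows) (sym (ℕΣ.*-distribˡ-sum N w)))
    rows₀ : ∀ i → sumℕ (c₀ i) ≡ N ℕ.* w₀ i
    rows₀ zero = begin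
      sumℕ (λ ℓ → N ℕ.∸ col ℓ)
        ≡⟨ ℕ.m+n∸n≡m _ (sumℕ col) ⟨
      sumℕ (λ ℓ → N ℕ.∸ col ℓ) ℕ.+ sumℕ col ℕ.∸ sumℕ col
        ≡⟨ cong (ℕ._∸ sumℕ col) (ℕΣ.∑-distrib-+ (λ ℓ → N ℕ.∸ col ℓ) col) ⟨
      sumℕ (λ ℓ → N ℕ.∸ col ℓ ℕ.+ col ℓ) ℕ.∸ sumℕ col
        ≡⟨ cong (ℕ._∸ sumℕ col) (ℕΣ.sum-cong-≗ λ ℓ → ℕ.m∸n+n≡m (columns ℓ)) ⟩
      sumℕ {k} (λ _ → N) ℕ.∸ sumℕ col
        ≡⟨ cong₂ ℕ._∸_ (sum-constℕ k N) Σcol ⟩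
      N ℕ.* k ℕ.∸ N ℕ.* sumℕ w
        ≡⟨ ℕ.*-distribˡ-∸ N k (sumℕ w) ⟨
      N ℕ.* (k ℕ.∸ sumℕ w)
        ∎
    rows₀ (suc i) = rows i
    columns₀ : ∀ ℓ → sumℕ (λ i → c₀ i ℓ) ≡ N ℕ.* 1
    columns₀ ℓ = trans (ℕ.m∸n+n≡m (columns ℓ)) (sym (ℕ.*-identityʳ N))
  ... | f , rowsᶠ , columnsᶠ , sumᶠ =
      (λ t i → f t (suc i)) , (λ t i → rowsᶠ t (suc i))
    , (λ t ℓ → subst (sumℕ (λ i → f t (suc i) ℓ) ℕ.≤_) (columnsᶠ t ℓ) (ℕ.m≤n+m _ (f t zero ℓ)))
    , λ i ℓ → sumᶠ (suc i) ℓ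

  -- Arrays as 0/1 tensors

  decode : ∀ {k} (v : Vector ℕ k) → sumℕ v ≡ 1 → Σ (Fin k) λ m → ∀ ℓ → v ℓ ≡ δ m ℓ
  decode {suc k} v Σv≡1 with v zero in v₀
  ... | suc a = zero , λ
    { zero    → trans v₀ (cong suc (ℕ.m+n≡0⇒m≡0 a (ℕ.suc-injective Σv≡1)))
    ; (suc ℓ) → sum≡0 (ℕ.m+n≡0⇒n≡0 a (ℕ.suc-injective Σv≡1)) ℓ }
  ... | zero with decode (v ∘ suc) Σv≡1
  ...   | m , v≡δ = suc m , λ { zero → v₀ ; (suc ℓ) → trans (v≡δ ℓ) (sym (δ-suc m ℓ)) }

  δ≡1⇒≡ : ∀ {k} {m ℓ : Fin k} → δ m ℓ ≡ 1 → m ≡ ℓ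
  δ≡1⇒≡ {m = m} {ℓ} eq with m ≟ ℓ
  ... | yes m≡ℓ = m≡ℓ
  ... | no _ = contradiction eq λ ()

  sum≤1⇒unique : ∀ {n} (v : Vector ℕ n) → sumℕ v ℕ.≤ 1 → ∀ i j → v i ≡ 1 → v j ≡ 1 → i ≡ j
  sum≤1⇒unique v Σv≤1 zero    zero    _   _   = refl
  sum≤1⇒unique v Σv≤1 (suc i) (suc j) vi vj =
    cong suc (sum≤1⇒unique (v ∘ suc) (ℕ.≤-trans (ℕ.m≤n+m _ (v zero)) Σv≤1) i j vi vj)
  sum≤1⇒unique v Σv≤1 zero    (suc j) vi vj = contradiction
    (ℕ.≤-trans (ℕ.+-mono-≤ (ℕ.≤-reflexive (sym vi))
        (ℕ.≤-trans (ℕ.≤-reflexive (sym vj)) (term≤sum (v ∘ suc) j))) Σv≤1)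
    λ { (s≤s ()) }
  sum≤1⇒unique v Σv≤1 (suc i) zero    vi vj = contradiction
    (ℕ.≤-trans (ℕ.+-mono-≤ (ℕ.≤-reflexive (sym vj))
        (ℕ.≤-trans (ℕ.≤-reflexive (sym vi)) (term≤sum (v ∘ suc) i))) Σv≤1)
    λ { (s≤s ()) }

  sum-δℕ : ∀ {n} (i : Fin n) → sumℕ (δ i) ≡ 1
  sum-δℕ i = sum-ℤ⇒ℕ (δ i) (trans (ℤΣ.sum-cong-≗ λ j → sym (ℤ.*-identityˡ (+ δ i j))) (sum-δ i λ _ → 1ℤ))

  ∣tabulate∣ : ∀ {n} (b : Fin n → Bool) → ∣ tabulate b ∣ ≡ sumℕ λ i → if b i then 1 else 0
  ∣tabulate∣ {zero}  b = refl
  ∣tabulate∣ {suc n} b with b zero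
  ... | true  = cong suc (∣tabulate∣ (b ∘ suc))
  ... | false = ∣tabulate∣ (b ∘ suc)

  inRow : ∀ {r s k} → Array r s k → Fin r → Fin k → ℕ
  inRow L i ℓ = sumℕ λ j → δ (L i j) ℓ

  occurrences-inRow : ∀ {r s k} (L : Array r s k) ℓ → occurrences L ℓ ≡ sumℕ λ i → inRow L i ℓ
  occurrences-inRow L ℓ = ℕΣ.sum-cong-≗ λ i → ∣tabulate∣ λ j → does (L i j ≟ ℓ)

  -- Equal entries in two cells of a row or column would put two ones on a line of `T`. Cells sum to
  -- exactly 1, but the other lines to at most 1, as a symbol may miss a row or a column.
  fromTensor : ∀ {r s k} (T : Fin r → Fin s → Fin k → ℕ) →
    (∀ i j → sumℕ (T i j) ≡ 1) →
    (∀ i ℓ → sumℕ (λ j → T i j ℓ) ℕ.≤ 1) →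
    (∀ j ℓ → sumℕ (λ i → T i j ℓ) ℕ.≤ 1) →
    Σ (Array r s k) λ M → IsLatin M × (∀ i j ℓ → T i j ℓ ≡ δ (M i j) ℓ)
  fromTensor {r} {s} {k} T cells rows columns = M , record { rows = injective ; columns = injectiveᵀ } , M-δ
    where
    M : Array r s k
    M i j = proj₁ (decode (T i j) (cells i j))
    M-δ : ∀ i j ℓ → T i j ℓ ≡ δ (M i j) ℓ
    M-δ i j = proj₂ (decode (T i j) (cells i j))
    hit : ∀ i j {ℓ} → M i j ≡ ℓ → T i j ℓ ≡ 1
    hit i j refl = trans (M-δ i j (M i j)) (δ-refl (M i j))
    injective : ∀ i {j j′} → M i j ≡ M i j′ → j ≡ j′
    injective i {j} {j′} eq =
      sum≤1⇒unique (λ j → T i j (M i j′)) (rows i (M i j′)) j j′ (hit i j eq) (hit i j′ refl)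
    injectiveᵀ : ∀ j {i i′} → M i j ≡ M i′ j → i ≡ i′
    injectiveᵀ j {i} {i′} eq =
      sum≤1⇒unique (λ i → T i j (M i′ j)) (columns j (M i′ j)) i i′ (hit i j eq) (hit i′ j refl)

  -- Gluing the blocks of a completion

  Fin-+-cases : ∀ r {p} {Q : Fin (r ℕ.+ p) → Set} →
    (∀ i → Q (i ↑ˡ p)) → (∀ t → Q (r ↑ʳ t)) → ∀ i → Q i
  Fin-+-cases r {p} {Q} top bottom i with splitAt r i | join-splitAt r p i
  ... | inj₁ i′ | refl = top i′
  ... | inj₂ t  | refl = bottom t

  sum-++ : ∀ r {p} (f : Vector ℕ (r ℕ.+ p)) {g : Vector ℕ r} {h : Vector ℕ p} →
    (∀ i → f (i ↑ˡ p) ≡ g i) → (∀ t → f (r ↑ʳ t) ≡ h t) → sumℕ f ≡ sumℕ g ℕ.+ sumℕ h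
  sum-++ r f f≡g f≡h = trans (sum-↑ r f) (cong₂ ℕ._+_ (ℕΣ.sum-cong-≗ f≡g) (ℕΣ.sum-cong-≗ f≡h))

  -- `F t` is the new row `t`: index `zero` collects the symbols of its corner cells, index `suc j`
  -- is the cell below column `j` of `L`. `H u i` is the cell of the new column `u` in row `i`, old
  -- or new. The last two hypotheses say that the new columns distribute exactly what `g` and the
  -- collected corner cells prescribe.
  glue : ∀ {r s k} p q (L : Array r s k) (g : Matrix r k)
    (F : Fin p → Matrix (suc s) k) (H : Fin q → Matrix (r ℕ.+ p) k) →
    (∀ t j → sumℕ (F t (suc j)) ≡ 1) → (∀ u i → sumℕ (H u i) ≡ 1) →
    (∀ i ℓ → inRow L i ℓ ℕ.+ g i ℓ ℕ.≤ 1) →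
    (∀ j ℓ → inRow (transpose L) j ℓ ℕ.+ sumℕ (λ t → F t (suc j) ℓ) ℕ.≤ 1) →
    (∀ t ℓ → sumℕ (λ j → F t j ℓ) ℕ.≤ 1) → (∀ u ℓ → sumℕ (λ i → H u i ℓ) ℕ.≤ 1) →
    (∀ i ℓ → sumℕ (λ u → H u (i ↑ˡ p) ℓ) ≡ g i ℓ) →
    (∀ t ℓ → sumℕ (λ u → H u (r ↑ʳ t) ℓ) ≡ F t zero ℓ) →
    Σ (Array (r ℕ.+ p) (s ℕ.+ q) k) λ M →
      IsLatin M
      × (∀ i j → M (i ↑ˡ p) (j ↑ˡ q) ≡ L i j)
      × (∀ ℓ → occurrences M ℓ
          ≡ occurrences L ℓ ℕ.+ sumℕ (λ i → g i ℓ) ℕ.+ sumℕ (λ t → sumℕ λ j → F t j ℓ))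
  glue {r} {s} {k} p q L g F H F-cells H-cells top-free left-free F-columns H-columns ΣH-top ΣH-bottom =
    M , proj₁ (proj₂ encoded) , extends , counts
    where
    left : Fin (r ℕ.+ p) → Fin s → Fin k → ℕ
    left = (λ i j → δ (L i j)) ++ λ t j → F t (suc j)

    T : Fin (r ℕ.+ p) → Fin (s ℕ.+ q) → Fin k → ℕ
    T i = left i ++ λ u → H u i

    T-left : ∀ i j → T i (j ↑ˡ q) ≡ left i j
    T-left i = lookup-++ˡ (left i) λ u → H u i
    T-right : ∀ i u → T i (s ↑ʳ u) ≡ H u i
    T-right i = lookup-++ʳ (left i) λ u → H u i
    left-top : ∀ i j → left (i ↑ˡ p) j ≡ δ (L i j)
    left-top i j = cong (_$ j) (lookup-++ˡ (λ i j → δ (L i j)) (λ t j → F t (suc j)) i)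
    left-bottom : ∀ t j → left (r ↑ʳ t) j ≡ F t (suc j)
    left-bottom t j = cong (_$ j) (lookup-++ʳ (λ i j → δ (L i j)) (λ t j → F t (suc j)) t)

    cells : ∀ i j → sumℕ (T i j) ≡ 1
    cells i = Fin-+-cases s
      (λ j → trans (cong sumℕ (T-left i j)) (Fin-+-cases r {Q = λ i → sumℕ (left i j) ≡ 1}
        (λ i → trans (cong sumℕ (left-top i j)) (sum-δℕ (L i j)))
        (λ t → trans (cong sumℕ (left-bottom t j)) (F-cells t j)) i))
      (λ u → trans (cong sumℕ (T-right i u)) (H-cells u i))

    row-top : ∀ i ℓ → sumℕ (λ j → T (i ↑ˡ p) j ℓ) ≡ inRow L i ℓ ℕ.+ g i ℓ
    row-top i ℓ = trans
      (sum-++ s (λ j → T (i ↑ˡ p) j ℓ)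
        (λ j → cong (_$ ℓ) (trans (T-left (i ↑ˡ p) j) (left-top i j)))
        (λ u → cong (_$ ℓ) (T-right (i ↑ˡ p) u)))
      (cong (ℕ._+_ (inRow L i ℓ)) (ΣH-top i ℓ))

    row-bottom : ∀ t ℓ → sumℕ (λ j → T (r ↑ʳ t) j ℓ) ≡ sumℕ (λ j → F t j ℓ)
    row-bottom t ℓ = trans
      (sum-++ s (λ j → T (r ↑ʳ t) j ℓ)
        (λ j → cong (_$ ℓ) (trans (T-left (r ↑ʳ t) j) (left-bottom t j)))
        (λ u → cong (_$ ℓ) (T-right (r ↑ʳ t) u)))
      (trans (cong (ℕ._+_ (sumℕ λ j → F t (suc j) ℓ)) (ΣH-bottom t ℓ)) (ℕ.+-comm _ (F t zero ℓ)))

    rows : ∀ i ℓ → sumℕ (λ j → T i j ℓ) ℕ.≤ 1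
    rows = Fin-+-cases r
      (λ i ℓ → subst (ℕ._≤ 1) (sym (row-top i ℓ)) (top-free i ℓ))
      (λ t ℓ → subst (ℕ._≤ 1) (sym (row-bottom t ℓ)) (F-columns t ℓ))

    columns : ∀ j ℓ → sumℕ (λ i → T i j ℓ) ℕ.≤ 1
    columns = Fin-+-cases s
      (λ j ℓ → subst (ℕ._≤ 1) (sym (sum-++ r (λ i → T i (j ↑ˡ q) ℓ)
          (λ i → cong (_$ ℓ) (trans (T-left (i ↑ˡ p) j) (left-top i j)))
          (λ t → cong (_$ ℓ) (trans (T-left (r ↑ʳ t) j) (left-bottom t j)))))
        (left-free j ℓ))
      (λ u ℓ → subst (ℕ._≤ 1) (ℕΣ.sum-cong-≗ λ i → sym (cong (_$ ℓ) (T-right i u))) (H-columns u ℓ))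

    encoded = fromTensor T cells rows columns
    M = proj₁ encoded
    M-δ = proj₂ (proj₂ encoded)

    extends : ∀ i j → M (i ↑ˡ p) (j ↑ˡ q) ≡ L i j
    extends i j = δ≡1⇒≡ (trans (sym (M-δ (i ↑ˡ p) (j ↑ˡ q) (L i j)))
      (trans (cong (_$ L i j) (trans (T-left (i ↑ˡ p) j) (left-top i j))) (δ-refl (L i j))))

    open ≡-Reasoning
    counts : ∀ ℓ → occurrences M ℓ
      ≡ occurrences L ℓ ℕ.+ sumℕ (λ i → g i ℓ) ℕ.+ sumℕ (λ t → sumℕ λ j → F t j ℓ)
    counts ℓ = begin
      occurrences M ℓ
        ≡⟨ occurrences-inRow M ℓ ⟩
      sumℕ (λ i → inRow M i ℓ)
        ≡⟨ ℕΣ.sum-cong-≗ (λ i → ℕΣ.sum-cong-≗ λ j → sym (M-δ i j ℓ)) ⟩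
      sumℕ (λ i → sumℕ λ j → T i j ℓ)
        ≡⟨ sum-++ r (λ i → sumℕ λ j → T i j ℓ) (λ i → row-top i ℓ) (λ t → row-bottom t ℓ) ⟩
      sumℕ (λ i → inRow L i ℓ ℕ.+ g i ℓ) ℕ.+ sumℕ (λ t → sumℕ λ j → F t j ℓ)
        ≡⟨ cong (ℕ._+ sumℕ (λ t → sumℕ λ j → F t j ℓ)) (ℕΣ.∑-distrib-+ (λ i → inRow L i ℓ) (λ i → g i ℓ)) ⟩
      sumℕ (λ i → inRow L i ℓ) ℕ.+ sumℕ (λ i → g i ℓ) ℕ.+ sumℕ (λ t → sumℕ λ j → F t j ℓ)
        ≡⟨ cong (λ e → e ℕ.+ sumℕ (λ i → g i ℓ) ℕ.+ sumℕ (λ t → sumℕ λ j → F t j ℓ)) (occurrences-inRow L ℓ) ⟨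
      occurrences L ℓ ℕ.+ sumℕ (λ i → g i ℓ) ℕ.+ sumℕ (λ t → sumℕ λ j → F t j ℓ)
        ∎

  -- The merged bottom row, with counts g′ and z, is split first, then the merged right-hand column.
  assemble : ∀ {r s k} p q (L : Array r s k) (g : Matrix r k) (g′ : Matrix s k) (z : Fin k → ℕ) →
    (∀ i → sumℕ (g i) ≡ q) → (∀ j → sumℕ (g′ j) ≡ p) → sumℕ z ≡ p ℕ.* q →
    (∀ i ℓ → inRow L i ℓ ℕ.+ g i ℓ ℕ.≤ 1) → (∀ j ℓ → inRow (transpose L) j ℓ ℕ.+ g′ j ℓ ℕ.≤ 1) →
    (∀ ℓ → sumℕ (λ i → g i ℓ) ℕ.+ z ℓ ℕ.≤ q) → (∀ ℓ → z ℓ ℕ.+ sumℕ (λ j → g′ j ℓ) ℕ.≤ p) →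
    Σ (Array (r ℕ.+ p) (s ℕ.+ q) k) λ M →
      IsLatin M
      × (∀ i j → M (i ↑ˡ p) (j ↑ˡ q) ≡ L i j)
      × (∀ ℓ → occurrences M ℓ
          ≡ occurrences L ℓ ℕ.+ sumℕ (λ i → g i ℓ) ℕ.+ (z ℓ ℕ.+ sumℕ (λ j → g′ j ℓ)))
  assemble {r} {s} {k} p q L g g′ z g-rows g′-rows Σz g-free g′-free g+z≤q z+g′≤p
    with split p bottom bottomWeight bottom-rows z+g′≤p
    where
    bottom : Matrix (suc s) k
    bottom zero    = z
    bottom (suc j) = g′ j
    bottomWeight : Fin (suc s) → ℕ
    -- The merged right-hand column stands for `q` cells of each new row, a column of `L` for one.
    bottomWeight zero    = q
    bottomWeight (suc j) = 1
    bottom-rows : ∀ j → sumℕ (bottom j) ≡ p ℕ.* bottomWeight j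
    bottom-rows zero    = Σz
    bottom-rows (suc j) = trans (g′-rows j) (sym (ℕ.*-identityʳ p))
  ... | F , F-rows , F-columns , ΣF
    with split q right (λ _ → 1) right-rows right-columns
    where
    right : Matrix (r ℕ.+ p) k
    -- After the first splitting every new row also has `q` symbols waiting in the merged column, so
    -- all `r + p` rows now have the same weight. The copies of `ℓ` there are those of `g` and the
    -- `z ℓ` of the corner.
    right = g ++ λ t → F t zero
    right-rows : ∀ i → sumℕ (right i) ≡ q ℕ.* 1
    right-rows = Fin-+-cases r
      (λ i → trans (cong sumℕ (lookup-++ˡ g (λ t → F t zero) i))
        (trans (g-rows i) (sym (ℕ.*-identityʳ q))))
      (λ t → trans (cong sumℕ (lookup-++ʳ g (λ t → F t zero) t))
        (trans (F-rows t zero) (sym (ℕ.*-identityʳ q))))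
    right-columns : ∀ ℓ → sumℕ (λ i → right i ℓ) ℕ.≤ q
    right-columns ℓ = subst (ℕ._≤ q)
      (sym (trans (sum-++ r (λ i → right i ℓ)
          (λ i → cong (_$ ℓ) (lookup-++ˡ g (λ t → F t zero) i))
          (λ t → cong (_$ ℓ) (lookup-++ʳ g (λ t → F t zero) t)))
        (cong (ℕ._+_ (sumℕ λ i → g i ℓ)) (ΣF zero ℓ))))
      (g+z≤q ℓ)
  ... | H , H-rows , H-columns , ΣH
    with glue p q L g F H (λ t j → F-rows t (suc j)) H-rows g-free
      (λ j ℓ → subst (λ n → inRow (transpose L) j ℓ ℕ.+ n ℕ.≤ 1) (sym (ΣF (suc j) ℓ)) (g′-free j ℓ))
      F-columns H-columns
      (λ i ℓ → trans (ΣH (i ↑ˡ p) ℓ) (cong (_$ ℓ) (lookup-++ˡ g (λ t → F t zero) i)))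
      (λ t ℓ → trans (ΣH (r ↑ʳ t) ℓ) (cong (_$ ℓ) (lookup-++ʳ g (λ t → F t zero) t)))
  ... | M , M-latin , M-extends , M-counts = M , M-latin , M-extends , λ ℓ → trans (M-counts ℓ)
    (cong (ℕ._+_ (occurrences L ℓ ℕ.+ sumℕ λ i → g i ℓ))
      (trans (ℕΣ.∑-comm λ t j → F t j ℓ) (cong₂ ℕ._+_ (ΣF zero ℓ) (ℕΣ.sum-cong-≗ λ j → ΣF (suc j) ℓ))))

  -- The six conditions as cut conditions

  ≤-⇔ : ∀ {x y x′ y′} → y - x ≡ y′ - x′ → x ≤ y ⇔ x′ ≤ y′
  ≤-⇔ eq = mk⇔ (≤-from-difference eq) (≤-from-difference (sym eq))

  Π-⇔ : ∀ {X : Set} {A B : X → Set} → (∀ x → A x ⇔ B x) → (∀ x → A x) ⇔ (∀ x → B x)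
  Π-⇔ eq = mk⇔ (λ f x → Equivalence.to (eq x) (f x)) (λ f x → Equivalence.from (eq x) (f x))

  ∁-involutive : ∀ {n} (K : Subset n) → ∁ (∁ K) ≡ K
  ∁-involutive []      = refl
  ∁-involutive (b ∷ K) = cong₂ _∷_ (not-involutive b) (∁-involutive K)

  Π-∁ : ∀ {n} {A : Subset n → Set} → (∀ K → A (∁ K)) ⇔ (∀ K → A K)
  Π-∁ {A = A} = mk⇔ (λ f K → subst A (∁-involutive K) (f (∁ K))) (λ f K → f (∁ K))

  mix : ∀ {n} → Subset n → (u v : Vector ℤ n) → Vector ℤ n
  mix K u v i = ⟦ K ⟧ i * u i + (1ℤ - ⟦ K ⟧ i) * v i

  mix-if : ∀ {n} (K : Subset n) u v i → mix K u v i ≡ (if lookup K i then u i else v i)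
  mix-if K u v i with lookup K i
  ... | true  = pick (u i) (v i)
    where
    pick : ∀ a b → 1ℤ * a + 0ℤ * b ≡ a
    pick = solve-∀
  ... | false = pick (u i) (v i)
    where
    pick : ∀ a b → 0ℤ * a + 1ℤ * b ≡ b
    pick = solve-∀

  -- The subset is chosen index by index, so the least mixed sum is the sum of the minima, attained
  -- where `u i ≤ v i` decides membership.
  ⊓-sum-⇔ : ∀ {n} (A : ℤ) (u v : Vector ℤ n) →
    (∀ K → A ≤ sumℤ (mix K u v)) ⇔ A ≤ sumℤ (λ i → u i ⊓ v i)
  ⊓-sum-⇔ {n} A u v = mk⇔
    (λ f → ℤ.≤-trans (f best) (sum-mono best-⊓))
    (λ A≤ K → ℤ.≤-trans A≤ (sum-mono (mix-⊓ K)))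
    where
    best : Subset n
    best = ⟪ (λ i → u i ℤ.≤? v i) ⟫
    best-⊓ : ∀ i → mix best u v i ≤ u i ⊓ v i
    best-⊓ i rewrite mix-if best u v i | lookup∘tabulate (λ i → does (u i ℤ.≤? v i)) i with u i ℤ.≤? v i
    ... | yes u≤v = ℤ.≤-reflexive (sym (ℤ.i≤j⇒i⊓j≡i u≤v))
    ... | no  u≰v = ℤ.≤-reflexive (sym (ℤ.i≥j⇒i⊓j≡j (ℤ.<⇒≤ (ℤ.≰⇒> u≰v))))
    mix-⊓ : ∀ K i → u i ⊓ v i ≤ mix K u v i
    mix-⊓ K i rewrite mix-if K u v i with lookup K i
    ... | true  = ℤ.i⊓j≤i (u i) (v i)
    ... | false = ℤ.i⊓j≤j (u i) (v i)

  sumOver-∁ : ∀ {n} (K : Subset n) u v →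
    sumOver K u + sumOver (∁ K) v ≡ sumℤ λ i → if lookup K i then u i else v i
  sumOver-∁ K u v = begin
    sumOver K u + sumOver (∁ K) v
      ≡⟨ cong₂ _+_ (sumOver-⟦⟧ K u) (sumOver-⟦⟧ (∁ K) v) ⟩
    weight K u + weight (∁ K) v
      ≡⟨ ℤΣ.∑-distrib-+ (λ i → ⟦ K ⟧ i * u i) _ ⟨
    sumℤ (λ i → ⟦ K ⟧ i * u i + ⟦ ∁ K ⟧ i * v i)
      ≡⟨ ℤΣ.sum-cong-≗ (λ i → trans (cong (λ c → ⟦ K ⟧ i * u i + c * v i) (⟦∁⟧ K i)) (mix-if K u v i)) ⟩
    sumℤ (λ i → if lookup K i then u i else v i)
      ∎
    where open ≡-Reasoning

  weight-const : ∀ {n} (K : Subset n) c → weight K (λ _ → c) ≡ + ∣ K ∣ * c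
  weight-const K c = trans (sym (ℤΣ.*-distribʳ-sum c ⟦ K ⟧)) (cong (_* c) (sym (∣∣-⟦⟧ K)))

  ∸-as-⊓ : ∀ x y → x ∸ y ≡ x - x ⊓ y
  ∸-as-⊓ x y = begin
    0ℤ ⊔ (x - y)            ≡⟨ cong (_⊔ (x - y)) (ℤ.+-inverseʳ x) ⟨
    (x - x) ⊔ (x - y)       ≡⟨ ℤ.antimono-≤-distrib-⊓ (λ {i} {j} i≤j → ℤ.+-monoʳ-≤ x (ℤ.neg-mono-≤ i≤j)) x y ⟨
    x - x ⊓ y               ∎
    where open ≡-Reasoning

  occurs : ∀ {r s k} → Array r s k → Fin r → Fin k → Bool
  occurs L i ℓ = does (any? λ j → L i j ≟ ℓ)

  absent : ∀ {r s k} → Array r s k → Matrix r k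
  absent L i ℓ = if not (occurs L i ℓ) then 1 else 0

  pos-if : ∀ b → + (if b then 1 else 0) ≡ χ b
  pos-if true  = refl
  pos-if false = refl

  ∣∩∣ : ∀ {n} (K K′ : Subset n) (f : Fin n → ℕ) → (∀ i → ⟦ K′ ⟧ i ≡ + f i) →
    + ∣ K ∩ K′ ∣ ≡ weight K (λ i → + f i)
  ∣∩∣ K K′ f f≡ = trans (∣∣-⟦⟧ (K ∩ K′)) (ℤΣ.sum-cong-≗ λ i → trans (⟦∩⟧ K K′ i) (cong (⟦ K ⟧ i *_) (f≡ i)))

  -- The n − t missing lines take at most n − t of the ρ_ℓ − e_ℓ outstanding copies of ℓ; the excess
  -- max{0, ρ_ℓ − e_ℓ − (n − t)} has to go into the t lines that are present.
  excess : ∀ {k} → ℕ → (ρ e : Fin k → ℕ) → ℕ → Fin k → ℤ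
  excess n ρ e t ℓ = ⟦ P n ρ e t ⟧ ℓ * ((+ ρ ℓ - + e ℓ) - (+ n - + t))

  weight-shifted : ∀ {n} (S : Subset n) f c →
    sumℤ (λ i → ⟦ S ⟧ i * (f i - c)) ≡ sumOver S f - + ∣ S ∣ * c
  weight-shifted S f c = begin
    sumℤ (λ i → ⟦ S ⟧ i * (f i - c))           ≡⟨ ℤΣ.sum-cong-≗ (λ i → expand (⟦ S ⟧ i) (f i) c) ⟩
    sumℤ (λ i → ⟦ S ⟧ i * f i - ⟦ S ⟧ i * c)   ≡⟨ sum-minus (λ i → ⟦ S ⟧ i * f i) _ ⟩
    weight S f - weight S (λ _ → c)            ≡⟨ cong₂ _-_ (sym (sumOver-⟦⟧ S f)) (weight-const S c) ⟩
    sumOver S f - + ∣ S ∣ * c                  ∎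
    where
    open ≡-Reasoning
    expand : ∀ a b c → a * (b - c) ≡ a * b - a * c
    expand = solve-∀

  sum-excess : ∀ {k} n (ρ e : Fin k → ℕ) t →
    sumℤ (excess n ρ e t)
      ≡ ∑[ ℓ ∈ P n ρ e t ] (+ ρ ℓ - + e ℓ) - + ∣ P n ρ e t ∣ * (+ n - + t)
  sum-excess n ρ e t = weight-shifted (P n ρ e t) (λ ℓ → + ρ ℓ - + e ℓ) (+ n - + t)

  module _ {r s k : ℕ} (n : ℕ) (ρ e : Fin k → ℕ) (L : Array r s k) (a : Fin k → ℕ) where
    open LineConditions n ρ e L a

    -- The number `x_ℓ`. On `Pᵣ` it is the expression `a_ℓ + ρ_ℓ - e_ℓ - n + r` of the first
    -- condition, elsewhere it is `a_ℓ`.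
    demand : Fin k → ℤ
    demand ℓ = + a ℓ + excess n ρ e r ℓ

    private
      d : ℤ
      d = + n - + s

      μˡ-weight : ∀ I ℓ → μˡ I ℓ ≡ weight I λ i → + absent L i ℓ
      μˡ-weight I ℓ = ∣∩∣ I (rowsWithout L ℓ) (λ i → absent L i ℓ) λ i →
        trans (cong χ (lookup∘tabulate (λ i → not (occurs L i ℓ)) i)) (sym (pos-if _))

      μˢ-weight : ∀ K i → μˢ K i ≡ weight K λ ℓ → + absent L i ℓ
      μˢ-weight K i = ∣∩∣ K (absentFromRow L i) (absent L i) λ ℓ →
        trans (cong χ (lookup∘tabulate (λ ℓ → not (occurs L i ℓ)) ℓ)) (sym (pos-if _))

      cut-columns : ∀ I K → cut (absent L) I K ≡ sumℤ λ ℓ → (1ℤ - ⟦ K ⟧ ℓ) * μˡ I ℓ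
      cut-columns I K = trans (ℤΣ.∑-comm λ i ℓ → ⟦ I ⟧ i * (1ℤ - ⟦ K ⟧ ℓ) * + absent L i ℓ)
        (ℤΣ.sum-cong-≗ λ ℓ → trans
          (ℤΣ.sum-cong-≗ λ i → swap (⟦ I ⟧ i) (1ℤ - ⟦ K ⟧ ℓ) (+ absent L i ℓ))
          (trans (sym (ℤΣ.*-distribˡ-sum (1ℤ - ⟦ K ⟧ ℓ) λ i → ⟦ I ⟧ i * + absent L i ℓ))
            (cong ((1ℤ - ⟦ K ⟧ ℓ) *_) (sym (μˡ-weight I ℓ)))))
        where
        swap : ∀ a b c → a * b * c ≡ b * (a * c)
        swap = solve-∀

      -- Taken at `∁ K`, because a cut counts the absent symbols outside its symbol set.
      cut-rows : ∀ I K → cut (absent L) I (∁ K) ≡ sumℤ λ i → ⟦ I ⟧ i * μˢ K i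
      cut-rows I K = ℤΣ.sum-cong-≗ λ i → trans
        (ℤΣ.sum-cong-≗ λ ℓ → trans
          (cong (λ c → ⟦ I ⟧ i * (1ℤ - c) * + absent L i ℓ) (⟦∁⟧ K ℓ))
          (swap (⟦ I ⟧ i) (⟦ K ⟧ ℓ) (+ absent L i ℓ)))
        (trans (sym (ℤΣ.*-distribˡ-sum (⟦ I ⟧ i) λ ℓ → ⟦ K ⟧ ℓ * + absent L i ℓ))
          (cong (⟦ I ⟧ i *_) (sym (μˢ-weight K i))))
        where
        swap : ∀ a b c → a * (1ℤ - (1ℤ - b)) * c ≡ a * (b * c)
        swap = solve-∀

      weight-demand : ∀ K → weight K demand
        ≡ ∑[ ℓ ∈ K ] (+ a ℓ) + (∑[ ℓ ∈ K ∩ Pᵣ ] (+ ρ ℓ - + e ℓ) - + ∣ K ∩ Pᵣ ∣ * (+ n - + r))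
      weight-demand K = begin
        weight K demand
          ≡⟨ ℤΣ.sum-cong-≗ (λ ℓ → trans
               (expand (⟦ K ⟧ ℓ) (+ a ℓ) (⟦ Pᵣ ⟧ ℓ) ((+ ρ ℓ - + e ℓ) - (+ n - + r)))
               (cong (λ c → ⟦ K ⟧ ℓ * + a ℓ + c * ((+ ρ ℓ - + e ℓ) - (+ n - + r))) (sym (⟦∩⟧ K Pᵣ ℓ)))) ⟩
        sumℤ (λ ℓ → ⟦ K ⟧ ℓ * + a ℓ + ⟦ K ∩ Pᵣ ⟧ ℓ * ((+ ρ ℓ - + e ℓ) - (+ n - + r)))
          ≡⟨ ℤΣ.∑-distrib-+ (λ ℓ → ⟦ K ⟧ ℓ * + a ℓ) _ ⟩
        weight K (λ ℓ → + a ℓ) + sumℤ (λ ℓ → ⟦ K ∩ Pᵣ ⟧ ℓ * ((+ ρ ℓ - + e ℓ) - (+ n - + r)))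
          ≡⟨ cong₂ _+_ (sym (sumOver-⟦⟧ K λ ℓ → + a ℓ))
               (weight-shifted (K ∩ Pᵣ) (λ ℓ → + ρ ℓ - + e ℓ) (+ n - + r)) ⟩
        ∑[ ℓ ∈ K ] (+ a ℓ) + (∑[ ℓ ∈ K ∩ Pᵣ ] (+ ρ ℓ - + e ℓ) - + ∣ K ∩ Pᵣ ∣ * (+ n - + r))
          ∎
        where
        open ≡-Reasoning
        expand : ∀ a b c d → a * (b + c * d) ≡ a * b + a * c * d
        expand = solve-∀

    RowFeasible : Set
    RowFeasible = Feasible (absent L) (λ _ → + n - + s) demand

    module _ (Σdemand : sumℤ demand ≡ + r * (+ n - + s))
             (count : ∀ ℓ → sumℤ (λ i → + absent L i ℓ) ≡ + r - + e ℓ) where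
      private
        -- For fixed `I`, a symbol contributes its demand to the slack if it is in `K` and `μˡ I ℓ`
        -- if not; the best `K` leaves a sum of minima.
        N₁ : Subset r → Set
        N₁ I = weight I (λ _ → d) ≤ sumℤ λ ℓ → demand ℓ ⊓ μˡ I ℓ

        -- The same with the roles exchanged: for fixed `K` the best `I` is found row by row, on
        -- complementary cuts.
        N₂ : Subset k → Set
        N₂ K = weight K demand ≤ sumℤ λ i → d ⊓ μˢ K i

        N₁⇔ : (∀ I → N₁ I) ⇔ RowFeasible
        N₁⇔ = Π-⇔ λ I → Π-⇔ (λ K → ≤-⇔ (by-columns I K)) ⇔-∘ ⇔-sym (⊓-sum-⇔ _ demand (μˡ I))
          where
          by-columns : ∀ I K → sumℤ (mix K demand (μˡ I)) - weight I (λ _ → d)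
                             ≡ slack (absent L) (λ _ → d) demand I K - 0ℤ
          by-columns I K = trans
            (cong (_- weight I (λ _ → d)) (trans (ℤΣ.∑-distrib-+ (λ ℓ → ⟦ K ⟧ ℓ * demand ℓ) _)
              (cong (_+_ (weight K demand)) (sym (cut-columns I K)))))
            (sym (ℤ.+-identityʳ (slack (absent L) (λ _ → d) demand I K)))

        N₆ : Subset r → Subset k → Set
        N₆ I K = weight K demand ≤ sumℤ (mix I (λ _ → d) (μˢ K))

        -- Both weights have total `r * d`, so replacing the sets by their complements turns
        -- `weight I d - weight K demand` into `weight (∁ K) demand - weight (∁ I) d`.
        N₆-difference : ∀ I K → sumℤ (mix I (λ _ → d) (μˢ K)) - weight K demand
                              ≡ slack (absent L) (λ _ → d) demand (∁ I) (∁ K) - 0ℤ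
        N₆-difference I K = begin
          sumℤ (mix I (λ _ → d) (μˢ K)) - weight K demand
            ≡⟨ cong (_- weight K demand) (ℤΣ.∑-distrib-+ (λ i → ⟦ I ⟧ i * d) _) ⟩
          weight I (λ _ → d) + sumℤ (λ i → (1ℤ - ⟦ I ⟧ i) * μˢ K i) - weight K demand
            ≡⟨ cong (λ c → weight I (λ _ → d) + c - weight K demand)
                 (trans (ℤΣ.sum-cong-≗ λ i → cong (_* μˢ K i) (sym (⟦∁⟧ I i))) (sym (cut-rows (∁ I) K))) ⟩
          weight I (λ _ → d) + cut (absent L) (∁ I) (∁ K) - weight K demand
            ≡⟨ shift (weight I λ _ → d) (cut (absent L) (∁ I) (∁ K)) (weight K demand) (+ r * d) ⟩
          (+ r * d - weight K demand) + cut (absent L) (∁ I) (∁ K) - (+ r * d - weight I (λ _ → d)) - 0ℤ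
            ≡⟨ cong₂ (λ X D → X + cut (absent L) (∁ I) (∁ K) - D - 0ℤ)
                 (trans (weight-∁ K demand) (cong (_- weight K demand) Σdemand))
                 (trans (weight-∁ I (λ _ → d)) (cong (_- weight I (λ _ → d)) (sum-const r d))) ⟨
          slack (absent L) (λ _ → d) demand (∁ I) (∁ K) - 0ℤ
            ∎
          where
          open ≡-Reasoning
          shift : ∀ i c x t → i + c - x ≡ (t - x) + c - (t - i) - 0ℤ
          shift = solve-∀

        N₆⇔ : (∀ I K → N₆ I K) ⇔ RowFeasible
        N₆⇔ = Π-∁ ⇔-∘ Π-⇔ (λ I → Π-∁ ⇔-∘ Π-⇔ λ K → ≤-⇔ (N₆-difference I K))

        flip-⇔ : ∀ {A B : Set} {Q : A → B → Set} → (∀ x y → Q x y) ⇔ (∀ y x → Q x y)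
        flip-⇔ = mk⇔ (λ f y x → f x y) (λ f x y → f y x)

        N₂⇔ : (∀ K → N₂ K) ⇔ RowFeasible
        N₂⇔ = N₆⇔ ⇔-∘ flip-⇔ ⇔-∘ Π-⇔ λ K → ⇔-sym (⊓-sum-⇔ _ (λ _ → d) (μˢ K))

        ∣I∣*d : ∀ (I : Subset r) → + ∣ I ∣ * d ≡ weight I (λ _ → d)
        ∣I∣*d I = sym (weight-const I d)

        demand-if : ∀ ℓ → demand ℓ ≡ (if lookup Pᵣ ℓ then + a ℓ + + ρ ℓ - + e ℓ - + n + + r else + a ℓ)
        demand-if ℓ with lookup Pᵣ ℓ
        ... | true  = regroup (+ a ℓ) (+ ρ ℓ) (+ e ℓ) (+ n) (+ r)
          where
          regroup : ∀ a ρ e n r → a + 1ℤ * ((ρ - e) - (n - r)) ≡ a + ρ - e - n + r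
          regroup = solve-∀
        ... | false = trans (cong (_+_ (+ a ℓ)) (ℤ.*-zeroˡ ((+ ρ ℓ - + e ℓ) - (+ n - + r))))
          (ℤ.+-identityʳ (+ a ℓ))

        -- By `count`, the rows that miss `ℓ` number `r - e ℓ`, and they are divided between `I` and
        -- `∁ I`.
        μˡ-∁ : ∀ I ℓ → μˡ (∁ I) ℓ ≡ + r - + e ℓ - μˡ I ℓ
        μˡ-∁ I ℓ = trans (μˡ-weight (∁ I) ℓ) (trans (weight-∁ I (λ i → + absent L i ℓ))
          (cong₂ _-_ (count ℓ) (sym (μˡ-weight I ℓ))))

        Cond₁⇔ : Cond₁ ⇔ RowFeasible
        Cond₁⇔ = N₁⇔ ⇔-∘ Π-⇔ λ I → ≤-⇔
          (cong₂ _-_ (trans (sumOver-∁ Pᵣ _ _) (ℤΣ.sum-cong-≗ (pointwise I))) (∣I∣*d I))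
          where
          pointwise : ∀ I ℓ →
            (if lookup Pᵣ ℓ then (+ a ℓ + + ρ ℓ - + e ℓ - + n + + r) ⊓ μˡ I ℓ else + a ℓ ⊓ μˡ I ℓ)
              ≡ demand ℓ ⊓ μˡ I ℓ
          pointwise I ℓ = trans (sym (if-float (_⊓ μˡ I ℓ) (lookup Pᵣ ℓ)))
            (cong (_⊓ μˡ I ℓ) (sym (demand-if ℓ)))

        Cond₂⇔ : Cond₂ ⇔ RowFeasible
        Cond₂⇔ = N₂⇔ ⇔-∘ Π-⇔ λ K → ≤-⇔ (trans
          (regroup (sumℤ λ i → d ⊓ μˢ K i) (∑[ ℓ ∈ K ] (+ a ℓ)) (+ ∣ K ∩ Pᵣ ∣ * (+ n - + r))
            (∑[ ℓ ∈ K ∩ Pᵣ ] (+ ρ ℓ - + e ℓ)))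
          (cong (_-_ (sumℤ λ i → d ⊓ μˢ K i)) (sym (weight-demand K))))
          where
          regroup : ∀ m a p ρ → m - a + p - ρ ≡ m - (a + (ρ - p))
          regroup = solve-∀

        -- This is `N₁` at `∁ I`, subtracted from the total demand, since `x ∸ y` is `x - x ⊓ y`.
        -- The bare `n` on `Pᵣ` arises when `μˡ (∁ I) ℓ` is replaced by `r - e ℓ - μˡ I ℓ`: then `r`
        -- and `e ℓ` cancel.
        Cond₃⇔ : Cond₃ ⇔ RowFeasible
        Cond₃⇔ = N₁⇔ ⇔-∘ Π-∁ ⇔-∘ Π-⇔ λ I → ≤-⇔ (begin
            + ∣ I ∣ * d - (∑[ ℓ ∈ Pᵣ ] ((+ a ℓ + + ρ ℓ + μˡ I ℓ) ∸ + n) + ∑[ ℓ ∈ ∁ Pᵣ ] (+ a ℓ ∸ μˡ (∁ I) ℓ))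
              ≡⟨ cong₂ _-_ (∣I∣*d I) (trans (sumOver-∁ Pᵣ _ _) (trans (ℤΣ.sum-cong-≗ (pointwise I))
                   (trans (sum-minus demand (λ ℓ → demand ℓ ⊓ μˡ (∁ I) ℓ)) (cong (_- M I) Σdemand)))) ⟩
            weight I (λ _ → d) - (+ r * d - M I)
              ≡⟨ regroup (weight I λ _ → d) (+ r * d) (M I) ⟩
            M I - (+ r * d - weight I (λ _ → d))
              ≡⟨ cong (_-_ (M I)) (trans (weight-∁ I (λ _ → d))
                 (cong (_- weight I (λ _ → d)) (sum-const r d))) ⟨
            M I - weight (∁ I) (λ _ → d)
              ∎)
          where
          open ≡-Reasoning
          M : Subset r → ℤ
          M I = sumℤ λ ℓ → demand ℓ ⊓ μˡ (∁ I) ℓ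
          regroup : ∀ w t m → w - (t - m) ≡ m - (t - w)
          regroup = solve-∀
          shift : ∀ a ρ m n e r → a + ρ + m - n ≡ a + ρ - e - n + r - (r - e - m)
          shift = solve-∀
          pointwise : ∀ I ℓ →
            (if lookup Pᵣ ℓ then (+ a ℓ + + ρ ℓ + μˡ I ℓ) ∸ + n else + a ℓ ∸ μˡ (∁ I) ℓ)
              ≡ demand ℓ - demand ℓ ⊓ μˡ (∁ I) ℓ
          pointwise I ℓ = trans
            (cong (λ x → if lookup Pᵣ ℓ then x else + a ℓ ∸ μˡ (∁ I) ℓ)
              (cong (0ℤ ⊔_) (trans (shift (+ a ℓ) (+ ρ ℓ) (μˡ I ℓ) (+ n) (+ e ℓ) (+ r))
                (cong (_-_ (+ a ℓ + + ρ ℓ - + e ℓ - + n + + r)) (sym (μˡ-∁ I ℓ))))))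
            (trans (sym (if-float (_∸ μˡ (∁ I) ℓ) (lookup Pᵣ ℓ)))
              (trans (cong (_∸ μˡ (∁ I) ℓ) (sym (demand-if ℓ))) (∸-as-⊓ (demand ℓ) (μˡ (∁ I) ℓ))))

        -- This is `N₂` at `∁ K`; the truncated differences are again complements of minima, now
        -- with total `r * d` over the rows.
        Cond₄⇔ : Cond₄ ⇔ RowFeasible
        Cond₄⇔ = N₂⇔ ⇔-∘ Π-∁ ⇔-∘ Π-⇔ λ K → ≤-⇔ (begin
            ρᴷ K - (sumℤ (λ i → d ∸ μˢ (∁ K) i) + pᴷ K - aᴷ K)
              ≡⟨ cong (λ m → ρᴷ K - (m + pᴷ K - aᴷ K)) (trans (ℤΣ.sum-cong-≗ λ i → ∸-as-⊓ d (μˢ (∁ K) i))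
                   (trans (sum-minus (λ _ → d) (λ i → d ⊓ μˢ (∁ K) i)) (cong (_- M K) (sum-const r d)))) ⟩
            ρᴷ K - (+ r * d - M K + pᴷ K - aᴷ K)
              ≡⟨ regroup (ρᴷ K) (+ r * d) (M K) (pᴷ K) (aᴷ K) ⟩
            M K - (+ r * d - (aᴷ K + (ρᴷ K - pᴷ K)))
              ≡⟨ cong (_-_ (M K)) (trans (weight-∁ K demand) (cong₂ _-_ Σdemand (weight-demand K))) ⟨
            M K - weight (∁ K) demand
              ∎)
          where
          open ≡-Reasoning
          M ρᴷ pᴷ aᴷ : Subset k → ℤ
          M K = sumℤ λ i → d ⊓ μˢ (∁ K) i
          ρᴷ K = ∑[ ℓ ∈ K ∩ Pᵣ ] (+ ρ ℓ - + e ℓ)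
          pᴷ K = + ∣ K ∩ Pᵣ ∣ * (+ n - + r)
          aᴷ K = ∑[ ℓ ∈ K ] (+ a ℓ)
          regroup : ∀ ρ t m p a → ρ - (t - m + p - a) ≡ m - (t - (a + (ρ - p)))
          regroup = solve-∀

        -- The slack itself, with the cut counted symbol by symbol.
        Cond₅⇔ : Cond₅ ⇔ RowFeasible
        Cond₅⇔ = Π-⇔ λ I → Π-⇔ λ K → ≤-⇔ (begin
            ρᴷ K + aᴷ K + ∑[ ℓ ∈ ∁ K ] (μˡ I ℓ) - pᴷ K - + ∣ I ∣ * d
              ≡⟨ cong₂ (λ c w → ρᴷ K + aᴷ K + c - pᴷ K - w)
                   (trans (sumOver-⟦⟧ (∁ K) (μˡ I))
                     (trans (ℤΣ.sum-cong-≗ λ ℓ → cong (_* μˡ I ℓ) (⟦∁⟧ K ℓ)) (sym (cut-columns I K))))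
                   (∣I∣*d I) ⟩
            ρᴷ K + aᴷ K + cut (absent L) I K - pᴷ K - weight I (λ _ → d)
              ≡⟨ regroup (ρᴷ K) (aᴷ K) (cut (absent L) I K) (pᴷ K) (weight I λ _ → d) ⟩
            aᴷ K + (ρᴷ K - pᴷ K) + cut (absent L) I K - weight I (λ _ → d) - 0ℤ
              ≡⟨ cong (λ x → x + cut (absent L) I K - weight I (λ _ → d) - 0ℤ) (weight-demand K) ⟨
            slack (absent L) (λ _ → d) demand I K - 0ℤ
              ∎)
          where
          open ≡-Reasoning
          ρᴷ pᴷ aᴷ : Subset k → ℤ
          ρᴷ K = ∑[ ℓ ∈ K ∩ Pᵣ ] (+ ρ ℓ - + e ℓ)
          pᴷ K = + ∣ K ∩ Pᵣ ∣ * (+ n - + r)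
          aᴷ K = ∑[ ℓ ∈ K ] (+ a ℓ)
          regroup : ∀ ρ a c p w → ρ + a + c - p - w ≡ a + (ρ - p) + c - w - 0ℤ
          regroup = solve-∀

        Cond₆⇔ : Cond₆ ⇔ RowFeasible
        Cond₆⇔ = N₆⇔ ⇔-∘ Π-⇔ λ I → Π-⇔ λ K → ≤-⇔ (begin
            + ∣ I ∣ * d + pᴷ K + ∑[ i ∈ ∁ I ] (μˢ K i) - aᴷ K - ρᴷ K
              ≡⟨ cong₂ (λ w c → w + pᴷ K + c - aᴷ K - ρᴷ K) (∣I∣*d I)
                   (trans (sumOver-⟦⟧ (∁ I) (μˢ K)) (ℤΣ.sum-cong-≗ λ i → cong (_* μˢ K i) (⟦∁⟧ I i))) ⟩
            weight I (λ _ → d) + pᴷ K + M I K - aᴷ K - ρᴷ K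
              ≡⟨ regroup (weight I λ _ → d) (pᴷ K) (M I K) (aᴷ K) (ρᴷ K) ⟩
            weight I (λ _ → d) + M I K - (aᴷ K + (ρᴷ K - pᴷ K))
              ≡⟨ cong₂ _-_ (ℤΣ.∑-distrib-+ (λ i → ⟦ I ⟧ i * d) _) (weight-demand K) ⟨
            sumℤ (mix I (λ _ → d) (μˢ K)) - weight K demand
              ∎)
          where
          open ≡-Reasoning
          M : Subset r → Subset k → ℤ
          M I K = sumℤ λ i → (1ℤ - ⟦ I ⟧ i) * μˢ K i
          ρᴷ pᴷ aᴷ : Subset k → ℤ
          ρᴷ K = ∑[ ℓ ∈ K ∩ Pᵣ ] (+ ρ ℓ - + e ℓ)
          pᴷ K = + ∣ K ∩ Pᵣ ∣ * (+ n - + r)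
          aᴷ K = ∑[ ℓ ∈ K ] (+ a ℓ)
          regroup : ∀ w p c a ρ → w + p + c - a - ρ ≡ w + c - (a + (ρ - p))
          regroup = solve-∀

      condition⇔Feasible : ∀ i → condition i ⇔ RowFeasible
      condition⇔Feasible 0F = Cond₁⇔
      condition⇔Feasible 1F = Cond₂⇔
      condition⇔Feasible 2F = Cond₃⇔
      condition⇔Feasible 3F = Cond₄⇔
      condition⇔Feasible 4F = Cond₅⇔
      condition⇔Feasible 5F = Cond₆⇔

  -- The easy half of Ore's theorem: each unit leaving a row of `I` is absorbed by a symbol of `K`
  -- or crosses the cut.
  routing⇒feasible : ∀ {m k} (c : Matrix m k) d x → Routing c d x → Feasible c d x
  routing⇒feasible c d x (f , f≤c , rows , columns) I K = ℤ.i≤j⇒0≤j-i (begin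
    weight I d
      ≡⟨ ℤΣ.sum-cong-≗ row ⟩
    pairing ⟦ I ⟧ (λ _ → 1ℤ) f
      ≤⟨ sum-mono (λ i → sum-mono λ ℓ → bits (lookup I i) (lookup K ℓ) (f≤c i ℓ)) ⟩
    sumℤ (λ i → sumℤ λ ℓ → ⟦ K ⟧ ℓ * 1ℤ * + f i ℓ + ⟦ I ⟧ i * (1ℤ - ⟦ K ⟧ ℓ) * + c i ℓ)
      ≡⟨ trans (ℤΣ.sum-cong-≗ λ i → ℤΣ.∑-distrib-+ (λ ℓ → ⟦ K ⟧ ℓ * 1ℤ * + f i ℓ) _)
               (ℤΣ.∑-distrib-+ (λ i → sumℤ λ ℓ → ⟦ K ⟧ ℓ * 1ℤ * + f i ℓ) _) ⟩
    sumℤ (λ i → sumℤ λ ℓ → ⟦ K ⟧ ℓ * 1ℤ * + f i ℓ) + cut c I K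
      ≡⟨ cong (_+ cut c I K) (trans (ℤΣ.∑-comm λ i ℓ → ⟦ K ⟧ ℓ * 1ℤ * + f i ℓ) (ℤΣ.sum-cong-≗ column)) ⟩
    weight K x + cut c I K
      ∎)
    where
    open ℤ.≤-Reasoning
    row : ∀ i → ⟦ I ⟧ i * d i ≡ sumℤ λ ℓ → ⟦ I ⟧ i * 1ℤ * + f i ℓ
    row i = trans (cong₂ _*_ (sym (ℤ.*-identityʳ (⟦ I ⟧ i))) (sym (rows i)))
      (ℤΣ.*-distribˡ-sum (⟦ I ⟧ i * 1ℤ) λ ℓ → + f i ℓ)
    column : ∀ ℓ → sumℤ (λ i → ⟦ K ⟧ ℓ * 1ℤ * + f i ℓ) ≡ ⟦ K ⟧ ℓ * x ℓ
    column ℓ = trans (sym (ℤΣ.*-distribˡ-sum (⟦ K ⟧ ℓ * 1ℤ) λ i → + f i ℓ))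
      (cong₂ _*_ (ℤ.*-identityʳ (⟦ K ⟧ ℓ)) (columns ℓ))
    bits : ∀ a b {f c} → f ℕ.≤ c → χ a * 1ℤ * + f ≤ χ b * 1ℤ * + f + χ a * (1ℤ - χ b) * + c
    bits true true {f} {c} f≤c = ℤ.≤-reflexive (keep (+ f) (+ c))
      where
      keep : ∀ f c → 1ℤ * 1ℤ * f ≡ 1ℤ * 1ℤ * f + 1ℤ * 0ℤ * c
      keep = solve-∀
    bits true false {f} {c} f≤c = subst₂ _≤_ (keep (+ f)) (add (+ f) (+ c)) (+≤+ f≤c)
      where
      keep : ∀ f → f ≡ 1ℤ * 1ℤ * f
      keep = solve-∀
      add : ∀ f c → c ≡ 0ℤ * 1ℤ * f + 1ℤ * 1ℤ * c
      add = solve-∀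
    bits false true {f} {c} f≤c = subst₂ _≤_ (drop (+ f)) (keep (+ f) (+ c)) (+≤+ (z≤n {f}))
      where
      drop : ∀ f → 0ℤ ≡ 0ℤ * 1ℤ * f
      drop = solve-∀
      keep : ∀ f c → f ≡ 1ℤ * 1ℤ * f + 0ℤ * 0ℤ * c
      keep = solve-∀
    bits false false {f} {c} f≤c = ℤ.≤-reflexive (drop (+ f) (+ c))
      where
      drop : ∀ f c → 0ℤ * 1ℤ * f ≡ 0ℤ * 1ℤ * f + 0ℤ * 1ℤ * c
      drop = solve-∀

  -- Counting in Latin arrays

  IsLatin-transpose : ∀ {r s k} {L : Array r s k} → IsLatin L → IsLatin (transpose L)
  IsLatin-transpose latin = record { rows = IsLatin.columns latin ; columns = IsLatin.rows latin }

  occurrences-transpose : ∀ {r s k} (L : Array r s k) ℓ → occurrences (transpose L) ℓ ≡ occurrences L ℓ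
  occurrences-transpose L ℓ = trans (occurrences-inRow (transpose L) ℓ)
    (trans (ℕΣ.∑-comm λ j i → δ (L i j) ℓ) (sym (occurrences-inRow L ℓ)))

  δ≢ : ∀ {n} {i j : Fin n} → ¬ i ≡ j → δ i j ≡ 0
  δ≢ {i = i} {j} i≢j with i ≟ j
  ... | yes i≡j = contradiction i≡j i≢j
  ... | no _    = refl

  inRow+absent : ∀ {r s k} {L : Array r s k} → IsLatin L → ∀ i ℓ → inRow L i ℓ ℕ.+ absent L i ℓ ≡ 1
  inRow+absent {s = s} {L = L} latin i ℓ with any? (λ j → L i j ≟ ℓ)
  ... | no ∄j = cong (ℕ._+ 1)
    (trans (ℕΣ.sum-cong-≗ λ j → δ≢ λ Lij≡ℓ → ∄j (j , Lij≡ℓ)) (ℕΣ.sum-replicate-zero s))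
  ... | yes (j₀ , refl) = trans (ℕ.+-identityʳ _) (trans (ℕΣ.sum-cong-≗ same) (sum-δℕ j₀))
    where
    same : ∀ j → δ (L i j) (L i j₀) ≡ δ j₀ j
    same j with j₀ ≟ j
    ... | yes refl = δ-refl (L i j)
    ... | no j₀≢j  = δ≢ λ eq → j₀≢j (sym (IsLatin.rows latin i eq))

  inRow≤1 : ∀ {r s k} {L : Array r s k} → IsLatin L → ∀ i ℓ → inRow L i ℓ ℕ.≤ 1
  inRow≤1 {L = L} latin i ℓ = subst (inRow L i ℓ ℕ.≤_) (inRow+absent latin i ℓ) (ℕ.m≤m+n _ _)

  sum-absent : ∀ {r s k} {L : Array r s k} → IsLatin L → ∀ ℓ →
    sumℤ (λ i → + absent L i ℓ) ≡ + r - + occurrences L ℓ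
  sum-absent {r} {L = L} latin ℓ = begin
    sumℤ (λ i → + absent L i ℓ)                     ≡⟨ pos-sum (λ i → absent L i ℓ) ⟨
    + A                                             ≡⟨ undo (+ A) (+ occurrences L ℓ) ⟩
    + occurrences L ℓ + + A - + occurrences L ℓ     ≡⟨ cong (_- + occurrences L ℓ) counted ⟩
    + r - + occurrences L ℓ                         ∎
    where
    open ≡-Reasoning
    A = sumℕ λ i → absent L i ℓ
    undo : ∀ a e → a ≡ e + a - e
    undo = solve-∀
    counted : + occurrences L ℓ + + A ≡ + r
    counted = trans (sym (ℤ.pos-+ (occurrences L ℓ) A)) (cong +_ total≡)
      where
      total≡ : occurrences L ℓ ℕ.+ A ≡ r
      total≡ = trans (cong (ℕ._+ A) (occurrences-inRow L ℓ))
        (trans (sym (ℕΣ.∑-distrib-+ (λ i → inRow L i ℓ) λ i → absent L i ℓ))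
          (trans (ℕΣ.sum-cong-≗ λ i → inRow+absent latin i ℓ) (trans (sum-constℕ r 1) (ℕ.*-identityˡ r))))

  sum-occurrences : ∀ {r s k} (L : Array r s k) → sumℕ (occurrences L) ≡ r ℕ.* s
  sum-occurrences {r} {s} L = begin
    sumℕ (occurrences L)                          ≡⟨ ℕΣ.sum-cong-≗ (occurrences-inRow L) ⟩
    sumℕ (λ ℓ → sumℕ λ i → inRow L i ℓ)           ≡⟨ ℕΣ.∑-comm (λ ℓ i → inRow L i ℓ) ⟩
    sumℕ (λ i → sumℕ λ ℓ → inRow L i ℓ)           ≡⟨ ℕΣ.sum-cong-≗ (λ i → sum-inRow L i) ⟩
    sumℕ {r} (λ i → s)                            ≡⟨ sum-constℕ r s ⟩
    s ℕ.* r                                       ≡⟨ ℕ.*-comm s r ⟩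
    r ℕ.* s                                       ∎
    where
    open ≡-Reasoning
    sum-inRow : ∀ {r s k} (L : Array r s k) i → sumℕ (inRow L i) ≡ s
    sum-inRow {s = s} L i = trans (ℕΣ.∑-comm λ ℓ j → δ (L i j) ℓ)
      (trans (ℕΣ.sum-cong-≗ λ j → sum-δℕ (L i j)) (trans (sum-constℕ s 1) (ℕ.*-identityˡ s)))

  -- Excesses and the fitting inequalities

  excess-cases : ∀ {k} n (ρ e : Fin k → ℕ) t ℓ (Q : ℤ → Set) →
    (+ n - + t < + ρ ℓ - + e ℓ → Q ((+ ρ ℓ - + e ℓ) - (+ n - + t))) →
    (+ ρ ℓ - + e ℓ ≤ + n - + t → Q 0ℤ) → Q (excess n ρ e t ℓ)
  excess-cases n ρ e t ℓ Q large small
    rewrite lookup∘tabulate (λ ℓ → does ((+ n - + t) ℤ.<? (+ ρ ℓ - + e ℓ))) ℓ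
    with (+ n - + t) ℤ.<? (+ ρ ℓ - + e ℓ)
  ... | yes n-t<ρ-e = subst Q (sym (ℤ.*-identityˡ _)) (large n-t<ρ-e)
  ... | no  n-t≮ρ-e = subst Q (sym (ℤ.*-zeroˡ ((+ ρ ℓ - + e ℓ) - (+ n - + t)))) (small (ℤ.≮⇒≥ n-t≮ρ-e))

  -- Sufficiency uses the excess through this lower bound and necessity through `excess-≤`; both see
  -- it only as a maximum with 0.
  excess-≥ : ∀ {k} n (ρ e : Fin k → ℕ) t ℓ → (+ ρ ℓ - + e ℓ) - (+ n - + t) ≤ excess n ρ e t ℓ
  excess-≥ n ρ e t ℓ = excess-cases n ρ e t ℓ ((+ ρ ℓ - + e ℓ) - (+ n - + t) ≤_)
    (λ _ → ℤ.≤-refl) ℤ.i≤j⇒i-j≤0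

  excess-≤ : ∀ {k} n (ρ e : Fin k → ℕ) t ℓ {y} → 0ℤ ≤ y →
    (+ ρ ℓ - + e ℓ) - (+ n - + t) ≤ y → excess n ρ e t ℓ ≤ y
  excess-≤ n ρ e t ℓ {y} 0≤y ≤y = excess-cases n ρ e t ℓ (_≤ y) (λ _ → ≤y) (λ _ → 0≤y)

  pos-∸ : ∀ {m n} → m ℕ.≤ n → + (n ℕ.∸ m) ≡ + n - + m
  pos-∸ {m} {n} m≤n = trans (sym (ℤ.⊖-≥ m≤n)) (sym (ℤ.m-n≡m⊖n n m))

  module _ {k : ℕ} (n : ℕ) (ρ e : Fin k → ℕ) where
    -- All three cases of the bound are what remains of `ρ_ℓ - e_ℓ` after both excesses are taken
    -- off. A fourth case, in the first set but not in the second, is excluded by `n - s ≤ n - r`.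
    nested-bound : ∀ {r s} → r ℕ.≤ s → ∀ ℓ →
      (if lookup (P n ρ e r) ℓ then + 2 * + n - + r - + s + + e ℓ - + ρ ℓ
       else if lookup (P n ρ e s) ℓ then + n - + s
       else + ρ ℓ - + e ℓ)
        ≡ + ρ ℓ - + e ℓ - excess n ρ e r ℓ - excess n ρ e s ℓ
    nested-bound {r} {s} r≤s ℓ
      rewrite lookup∘tabulate (λ ℓ → does ((+ n - + r) ℤ.<? (+ ρ ℓ - + e ℓ))) ℓ
            | lookup∘tabulate (λ ℓ → does ((+ n - + s) ℤ.<? (+ ρ ℓ - + e ℓ))) ℓ
      with (+ n - + r) ℤ.<? (+ ρ ℓ - + e ℓ) | (+ n - + s) ℤ.<? (+ ρ ℓ - + e ℓ)
    ... | yes _ | yes _ = both (+ n) (+ r) (+ s) (+ e ℓ) (+ ρ ℓ)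
      where
      both : ∀ n r s e ρ → + 2 * n - r - s + e - ρ
        ≡ ρ - e - 1ℤ * ((ρ - e) - (n - r)) - 1ℤ * ((ρ - e) - (n - s))
      both = solve-∀
    ... | yes n-r<ρ-e | no n-s≮ρ-e = contradiction
      (ℤ.≤-<-trans (ℤ.+-monoʳ-≤ (+ n) (ℤ.neg-mono-≤ (+≤+ r≤s))) n-r<ρ-e) n-s≮ρ-e
    ... | no _ | yes _ = larger (+ n) (+ r) (+ s) (+ e ℓ) (+ ρ ℓ)
      where
      larger : ∀ n r s e ρ → n - s ≡ ρ - e - 0ℤ * ((ρ - e) - (n - r)) - 1ℤ * ((ρ - e) - (n - s))
      larger = solve-∀
    ... | no _ | no _ = neither (+ n) (+ r) (+ s) (+ e ℓ) (+ ρ ℓ)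
      where
      neither : ∀ n r s e ρ → ρ - e ≡ ρ - e - 0ℤ * ((ρ - e) - (n - r)) - 0ℤ * ((ρ - e) - (n - s))
      neither = solve-∀

    bound-excess : ∀ r s ℓ →
      (if lookup (P n ρ e (r ℕ.⊓ s)) ℓ then + 2 * + n - + r - + s + + e ℓ - + ρ ℓ
       else if lookup (P n ρ e (r ℕ.⊔ s)) ℓ then + n - + (r ℕ.⊔ s)
       else + ρ ℓ - + e ℓ)
        ≡ + ρ ℓ - + e ℓ - excess n ρ e r ℓ - excess n ρ e s ℓ
    bound-excess r s ℓ with ℕ.≤-total r s
    ... | inj₁ r≤s rewrite ℕ.m≤n⇒m⊓n≡m r≤s | ℕ.m≤n⇒m⊔n≡n r≤s = nested-bound r≤s ℓ
    ... | inj₂ s≤r rewrite ℕ.m≥n⇒m⊓n≡n s≤r | ℕ.m≥n⇒m⊔n≡m s≤r =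
      trans (cong (λ x → if lookup (P n ρ e s) ℓ then x
                   else if lookup (P n ρ e r) ℓ then + n - + r else + ρ ℓ - + e ℓ)
              (swap₁ (+ n) (+ r) (+ s) (+ e ℓ) (+ ρ ℓ)))
        (trans (nested-bound s≤r ℓ) (swap₂ (+ ρ ℓ - + e ℓ) (excess n ρ e s ℓ) (excess n ρ e r ℓ)))
      where
      swap₁ : ∀ n r s e ρ → + 2 * n - r - s + e - ρ ≡ + 2 * n - s - r + e - ρ
      swap₁ = solve-∀
      swap₂ : ∀ a b c → a - b - c ≡ a - c - b
      swap₂ = solve-∀

    sum-demand : ∀ {r s} (L : Array r s k) a →
      sumℤ (demand n ρ e L a) ≡ + sumℕ a + (∑[ ℓ ∈ P n ρ e r ] (+ ρ ℓ - + e ℓ) - + ∣ P n ρ e r ∣ * (+ n - + r))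
    sum-demand {r} L a = trans (ℤΣ.∑-distrib-+ (λ ℓ → + a ℓ) (excess n ρ e r))
      (cong₂ _+_ (sym (pos-sum a)) (sum-excess n ρ e r))

    -- The total prescribed for `a` is the number `r * (n - s)` of cells to the right of `L`, less
    -- the excesses placed there by force.
    demand-total⇔ : ∀ {r s} (L : Array r s k) a →
      + sumℕ a ≡ + r * (+ n - + s) + + ∣ P n ρ e r ∣ * (+ n - + r) - ∑[ ℓ ∈ P n ρ e r ] (+ ρ ℓ - + e ℓ)
        ⇔ sumℤ (demand n ρ e L a) ≡ + r * (+ n - + s)
    demand-total⇔ {r} {s} L a = mk⇔
      (λ eq → trans (sum-demand L a) (trans (cong (_+ (v - u)) eq) (cancel t u v)))
      (λ eq → trans (undo (+ sumℕ a) u v) (cong (λ t → t + u - v) (trans (sym (sum-demand L a)) eq)))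
      where
      t = + r * (+ n - + s)
      u = + ∣ P n ρ e r ∣ * (+ n - + r)
      v = ∑[ ℓ ∈ P n ρ e r ] (+ ρ ℓ - + e ℓ)
      cancel : ∀ t u v → t + u - v + (v - u) ≡ t
      cancel = solve-∀
      undo : ∀ a u v → a ≡ a + (v - u) + u - v
      undo = solve-∀

  -- From routings to a completion

  Completion : ∀ {r s k} → ℕ → ℕ → (Fin k → ℕ) → Array r s k → Set
  Completion {r} {s} {k} p q ρ L = Σ (Array (r ℕ.+ p) (s ℕ.+ q) k) λ M →
    IsLatin M × (∀ i j → M (i ↑ˡ p) (j ↑ˡ q) ≡ L i j) × (∀ ℓ → occurrences M ℓ ≡ ρ ℓ)

  inject≤≡↑ˡ : ∀ {r p} .(r≤ : r ℕ.≤ r ℕ.+ p) (i : Fin r) → inject≤ i r≤ ≡ i ↑ˡ p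
  inject≤≡↑ˡ {p = p} r≤ i = toℕ-injective (trans (toℕ-inject≤ i r≤) (sym (toℕ-↑ˡ i p)))

  -- Sizes written as sums make old and new lines the two injections. The two sides have separate
  -- names `n` and `n′` so that both equations can be matched with `refl`.
  completion⇔ : ∀ {r s k p q n n′} → r ℕ.+ p ≡ n → s ℕ.+ q ≡ n′ →
    .(r≤n : r ℕ.≤ n) .(s≤n′ : s ℕ.≤ n′) (ρ : Fin k → ℕ) (L : Array r s k) →
    Completion p q ρ L ⇔ Σ (Array n n′ k) λ M →
      IsLatin M × (∀ i j → M (inject≤ i r≤n) (inject≤ j s≤n′) ≡ L i j) × (∀ ℓ → occurrences M ℓ ≡ ρ ℓ)
  completion⇔ refl refl r≤n s≤n′ ρ L = mk⇔
    (λ (M , latin , extends , counts) → M , latin , (λ i j → trans (same M i j) (extends i j)) , counts)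
    (λ (M , latin , extends , counts) → M , latin , (λ i j → trans (sym (same M i j)) (extends i j)) , counts)
    where
    same : ∀ M i j → M (inject≤ i r≤n) (inject≤ j s≤n′) ≡ M (i ↑ˡ _) (j ↑ˡ _)
    same M i j = cong₂ M (inject≤≡↑ˡ r≤n i) (inject≤≡↑ˡ s≤n′ j)

  module _ {n k} (ρ : Fin k → ℕ) {r s p q} (r+p≡n : r ℕ.+ p ≡ n) (s+q≡n : s ℕ.+ q ≡ n)
           (L : Array r s k) (latin : IsLatin L) where
    private
      e : Fin k → ℕ
      e = occurrences L

      p≡ : + p ≡ + n - + r
      p≡ = trans (cong +_ (trans (sym (ℕ.m+n∸m≡n r p)) (cong (ℕ._∸ r) r+p≡n)))
        (pos-∸ (subst (r ℕ.≤_) r+p≡n (ℕ.m≤m+n r p)))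
      q≡ : + q ≡ + n - + s
      q≡ = trans (cong +_ (trans (sym (ℕ.m+n∸m≡n s q)) (cong (ℕ._∸ s) s+q≡n)))
        (pos-∸ (subst (s ℕ.≤_) s+q≡n (ℕ.m≤m+n s q)))

    module _ (Σρ : sumℕ ρ ≡ n ℕ.* n) (a b : Fin k → ℕ) where
      private
        x y : Fin k → ℤ
        x = demand n ρ e L a
        y = demand n ρ e (transpose L) b

      -- The routings settle what stands to the right of `L` and below it; the corner receives the
      -- remaining copies of each symbol, a nonnegative number by the bound on `x ℓ + y ℓ`.
      sufficient : sumℤ x ≡ + r * (+ n - + s) → sumℤ y ≡ + s * (+ n - + r) →
        (∀ ℓ → x ℓ + y ℓ ≤ + ρ ℓ - + e ℓ) →
        RowFeasible n ρ e L a → RowFeasible n ρ e (transpose L) b → Completion p q ρ L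
      sufficient Σx Σy x+y≤ feasibleʳ feasibleᶜ
        with ore (absent L) (λ _ → + n - + s) x (trans (sum-const r _) (sym Σx)) feasibleʳ
           | ore (absent (transpose L)) (λ _ → + n - + r) y (trans (sum-const s _) (sym Σy)) feasibleᶜ
      ... | g , g≤ , g-rows , g-columns | g′ , g′≤ , g′-rows , g′-columns =
        proj₁ built , proj₁ (proj₂ built) , proj₁ (proj₂ (proj₂ built)) ,
        λ ℓ → trans (proj₂ (proj₂ (proj₂ built)) ℓ)
        (trans (regroup (e ℓ) (xℕ ℓ) (yℕ ℓ) (z ℓ)) (ℕ.m∸n+n≡m (used≤ρ ℓ)))
        where
        xℕ yℕ z : Fin k → ℕ
        xℕ ℓ = sumℕ λ i → g i ℓ
        yℕ ℓ = sumℕ λ j → g′ j ℓ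
        z  ℓ = ρ ℓ ℕ.∸ (e ℓ ℕ.+ xℕ ℓ ℕ.+ yℕ ℓ)
        regroup : ∀ e x y z → e ℕ.+ x ℕ.+ (z ℕ.+ y) ≡ z ℕ.+ (e ℕ.+ x ℕ.+ y)
        regroup = ℕ-Ring.solve-∀
        x≡ : ∀ ℓ → + xℕ ℓ ≡ x ℓ
        x≡ ℓ = trans (pos-sum λ i → g i ℓ) (g-columns ℓ)
        y≡ : ∀ ℓ → + yℕ ℓ ≡ y ℓ
        y≡ ℓ = trans (pos-sum λ j → g′ j ℓ) (g′-columns ℓ)
        used : ∀ ℓ → + (e ℓ ℕ.+ xℕ ℓ ℕ.+ yℕ ℓ) ≡ + e ℓ + x ℓ + y ℓ
        used ℓ = trans (ℤ.pos-+ (e ℓ ℕ.+ xℕ ℓ) (yℕ ℓ))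
          (cong₂ _+_ (trans (ℤ.pos-+ (e ℓ) (xℕ ℓ)) (cong (_+_ (+ e ℓ)) (x≡ ℓ))) (y≡ ℓ))
        used≤ρ : ∀ ℓ → e ℓ ℕ.+ xℕ ℓ ℕ.+ yℕ ℓ ℕ.≤ ρ ℓ
        used≤ρ ℓ = ℤ.drop‿+≤+ (subst (_≤ + ρ ℓ) (sym (used ℓ))
          (≤-from-difference (shift (+ ρ ℓ) (+ e ℓ) (x ℓ) (y ℓ)) (x+y≤ ℓ)))
          where
          shift : ∀ ρ e x y → ρ - e - (x + y) ≡ ρ - (e + x + y)
          shift = solve-∀
        z≡ : ∀ ℓ → + z ℓ ≡ + ρ ℓ - (+ e ℓ + x ℓ + y ℓ)
        z≡ ℓ = trans (pos-∸ (used≤ρ ℓ)) (cong (_-_ (+ ρ ℓ)) (used ℓ))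
        excess≤ : ∀ (a : Fin k → ℕ) t ℓ → excess n ρ e t ℓ ≤ + a ℓ + excess n ρ e t ℓ
        excess≤ a t ℓ = ℤ.i≤j+i (excess n ρ e t ℓ) (+ a ℓ)
        -- Inserting `z` cancels `x`: the claim is `ρ - e - y ≤ n - s`, so the capacity of the new
        -- columns is guarded by the excess contained in the column demand `y`.
        x+z≤q : ∀ ℓ → xℕ ℓ ℕ.+ z ℓ ℕ.≤ q
        x+z≤q ℓ = ℤ.drop‿+≤+ (subst₂ _≤_
          (sym (trans (ℤ.pos-+ (xℕ ℓ) (z ℓ)) (cong₂ _+_ (x≡ ℓ) (z≡ ℓ)))) (sym q≡)
          (≤-from-difference (shift (+ ρ ℓ) (+ e ℓ) (x ℓ) (y ℓ) (+ n - + s))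
            (ℤ.≤-trans (excess-≥ n ρ e s ℓ) (excess≤ b s ℓ))))
          where
          shift : ∀ ρ e x y d → y - ((ρ - e) - d) ≡ d - (x + (ρ - (e + x + y)))
          shift = solve-∀
        z+y≤p : ∀ ℓ → z ℓ ℕ.+ yℕ ℓ ℕ.≤ p
        z+y≤p ℓ = ℤ.drop‿+≤+ (subst₂ _≤_
          (sym (trans (ℤ.pos-+ (z ℓ) (yℕ ℓ)) (cong₂ _+_ (z≡ ℓ) (y≡ ℓ)))) (sym p≡)
          (≤-from-difference (shift (+ ρ ℓ) (+ e ℓ) (x ℓ) (y ℓ) (+ n - + r))
            (ℤ.≤-trans (excess-≥ n ρ e r ℓ) (excess≤ a r ℓ))))
          where
          shift : ∀ ρ e x y d → x - ((ρ - e) - d) ≡ d - (ρ - (e + x + y) + y)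
          shift = solve-∀
        -- The `n * n` cells minus those of `L` and of the two strips beside it.
        Σz : sumℕ z ≡ p ℕ.* q
        Σz = sum-ℤ⇒ℕ z (begin
          sumℤ (λ ℓ → + z ℓ)
            ≡⟨ ℤΣ.sum-cong-≗ z≡ ⟩
          sumℤ (λ ℓ → + ρ ℓ - (+ e ℓ + x ℓ + y ℓ))
            ≡⟨ sum-minus (λ ℓ → + ρ ℓ) (λ ℓ → + e ℓ + x ℓ + y ℓ) ⟩
          sumℤ (λ ℓ → + ρ ℓ) - sumℤ (λ ℓ → + e ℓ + x ℓ + y ℓ)
            ≡⟨ cong (_-_ (sumℤ λ ℓ → + ρ ℓ)) (trans (ℤΣ.∑-distrib-+ (λ ℓ → + e ℓ + x ℓ) y)
                 (cong (_+ sumℤ y) (ℤΣ.∑-distrib-+ (λ ℓ → + e ℓ) x))) ⟩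
          sumℤ (λ ℓ → + ρ ℓ) - (sumℤ (λ ℓ → + e ℓ) + sumℤ x + sumℤ y)
            ≡⟨ cong₂ _-_ (trans (sym (pos-sum ρ)) (trans (cong +_ Σρ) (ℤ.pos-* n n)))
                 (cong₂ _+_ (cong₂ _+_ Σe Σx) Σy) ⟩
          + n * + n - (+ r * + s + + r * (+ n - + s) + + s * (+ n - + r))
            ≡⟨ factor (+ n) (+ r) (+ s) ⟩
          (+ n - + r) * (+ n - + s)
            ≡⟨ cong₂ _*_ p≡ q≡ ⟨
          + p * + q
            ≡⟨ ℤ.pos-* p q ⟨
          + (p ℕ.* q)
            ∎)
          where
          open ≡-Reasoning
          Σe : sumℤ (λ ℓ → + e ℓ) ≡ + r * + s
          Σe = trans (sym (pos-sum e)) (trans (cong +_ (sum-occurrences L)) (ℤ.pos-* r s))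
          factor : ∀ n r s → n * n - (r * s + r * (n - s) + s * (n - r)) ≡ (n - r) * (n - s)
          factor = solve-∀
        built = assemble p q L g g′ z
          (λ i → sum-ℤ⇒ℕ (g i) (trans (g-rows i) (sym q≡)))
          (λ j → sum-ℤ⇒ℕ (g′ j) (trans (g′-rows j) (sym p≡)))
          Σz
          (λ i ℓ → subst (inRow L i ℓ ℕ.+ g i ℓ ℕ.≤_) (inRow+absent latin i ℓ) (ℕ.+-monoʳ-≤ _ (g≤ i ℓ)))
          (λ j ℓ → subst (inRow (transpose L) j ℓ ℕ.+ g′ j ℓ ℕ.≤_)
            (inRow+absent (IsLatin-transpose latin) j ℓ) (ℕ.+-monoʳ-≤ _ (g′≤ j ℓ)))
          x+z≤q z+y≤p

  -- From a completion to routings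

  sum-monoℕ : ∀ {n} {f g : Vector ℕ n} → (∀ i → f i ℕ.≤ g i) → sumℕ f ℕ.≤ sumℕ g
  sum-monoℕ {zero}  f≤g = z≤n
  sum-monoℕ {suc n} f≤g = ℕ.+-mono-≤ (f≤g zero) (sum-monoℕ (f≤g ∘ suc))

  -- Applied to the transpose of `M`, it counts what stands below the old block.
  rightCount : ∀ {k} r p s q → Array (r ℕ.+ p) (s ℕ.+ q) k → Matrix r k
  rightCount r p s q M i ℓ = sumℕ λ u → δ (M (i ↑ˡ p) (s ↑ʳ u)) ℓ

  module Restriction {k} r p s q (M : Array (r ℕ.+ p) (s ℕ.+ q) k) (M-latin : IsLatin M)
                     (L : Array r s k) (extends : ∀ i j → M (i ↑ˡ p) (j ↑ˡ q) ≡ L i j) where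
    private
      g : Matrix r k
      g = rightCount r p s q M

      x w : Fin k → ℕ
      x ℓ = sumℕ λ i → g i ℓ
      w ℓ = sumℕ λ t → inRow M (r ↑ʳ t) ℓ

      inRow-top : ∀ i ℓ → inRow M (i ↑ˡ p) ℓ ≡ inRow L i ℓ ℕ.+ g i ℓ
      inRow-top i ℓ = sum-++ s (λ j → δ (M (i ↑ˡ p) j) ℓ)
        (λ j → cong (λ m → δ m ℓ) (extends i j)) (λ u → refl)

    occurrences-top : ∀ ℓ → occurrences M ℓ ≡ occurrences L ℓ ℕ.+ x ℓ ℕ.+ w ℓ
    occurrences-top ℓ = trans (occurrences-inRow M ℓ)
      (trans (sum-++ r (λ i → inRow M i ℓ) (λ i → inRow-top i ℓ) (λ t → refl))
        (cong (ℕ._+ w ℓ) (trans (ℕΣ.∑-distrib-+ (λ i → inRow L i ℓ) λ i → g i ℓ)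
          (cong (ℕ._+ x ℓ) (sym (occurrences-inRow L ℓ))))))

    bottom-left≤ : ∀ ℓ → sumℕ (λ j → rightCount s q r p (transpose M) j ℓ) ℕ.≤ w ℓ
    bottom-left≤ ℓ = subst (ℕ._≤ w ℓ) (ℕΣ.∑-comm λ t j → δ (M (r ↑ʳ t) (j ↑ˡ q)) ℓ)
      (sum-monoℕ λ t → subst (sumℕ (λ j → δ (M (r ↑ʳ t) (j ↑ˡ q)) ℓ) ℕ.≤_)
        (sym (sum-↑ s λ j → δ (M (r ↑ʳ t) j) ℓ)) (ℕ.m≤m+n _ _))

    -- `e` is kept apart from `occurrences L` so that the instance for the transposed arrays speaks
    -- of the same counts as the instance for rows.
    module Counted {n} (ρ e : Fin k → ℕ) (counts : ∀ ℓ → occurrences M ℓ ≡ ρ ℓ)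
                   (e≡ : ∀ ℓ → e ℓ ≡ occurrences L ℓ) (latin : IsLatin L)
                   (p≡ : + p ≡ + n - + r) (q≡ : + q ≡ + n - + s) where
      private
        ρ≡ : ∀ ℓ → + ρ ℓ ≡ + e ℓ + + x ℓ + + w ℓ
        ρ≡ ℓ = trans (cong +_ (trans (sym (counts ℓ)) (trans (occurrences-top ℓ)
            (cong (λ e → e ℕ.+ x ℓ ℕ.+ w ℓ) (sym (e≡ ℓ))))))
          (trans (ℤ.pos-+ (e ℓ ℕ.+ x ℓ) (w ℓ)) (cong (_+ + w ℓ) (ℤ.pos-+ (e ℓ) (x ℓ))))

        w≤p : ∀ ℓ → w ℓ ℕ.≤ p
        w≤p ℓ = subst (w ℓ ℕ.≤_) (trans (sum-constℕ p 1) (ℕ.*-identityˡ p))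
          (sum-monoℕ λ t → inRow≤1 M-latin (r ↑ʳ t) ℓ)

        -- The `w ℓ` copies not in the old rows lie in `p = n - r` rows, at most one in each.
        excess≤x : ∀ ℓ → excess n ρ e r ℓ ≤ + x ℓ
        excess≤x ℓ = excess-≤ n ρ e r ℓ (+≤+ z≤n)
          (≤-from-difference (trans (shift (+ e ℓ) (+ x ℓ) (+ w ℓ) (+ p))
              (cong₂ (λ ρ d → + x ℓ - (ρ - + e ℓ - d)) (sym (ρ≡ ℓ)) p≡))
            (+≤+ (w≤p ℓ)))
          where
          shift : ∀ e x w p → p - w ≡ x - (e + x + w - e - p)
          shift = solve-∀

      -- The sequence `a` (or `b`) read off from the completion. By `excess≤x` the absolute value is
      -- of a nonnegative integer.
      leftover : Fin k → ℕ
      leftover ℓ = ℤ.∣ + x ℓ - excess n ρ e r ℓ ∣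

      demand-leftover : ∀ ℓ → demand n ρ e L leftover ℓ ≡ + x ℓ
      demand-leftover ℓ = trans
        (cong (_+ excess n ρ e r ℓ) (ℤ.0≤i⇒+∣i∣≡i (ℤ.i≤j⇒0≤j-i (excess≤x ℓ))))
        (undo (+ x ℓ) (excess n ρ e r ℓ))
        where
        undo : ∀ x y → x - y + y ≡ x
        undo = solve-∀

      private
        g-rows : ∀ i → sumℤ (λ ℓ → + g i ℓ) ≡ + n - + s
        g-rows i = trans (sym (pos-sum (g i))) (trans (cong +_ (trans
            (ℕΣ.∑-comm λ ℓ u → δ (M (i ↑ˡ p) (s ↑ʳ u)) ℓ)
            (trans (ℕΣ.sum-cong-≗ λ u → sum-δℕ (M (i ↑ˡ p) (s ↑ʳ u)))
              (trans (sum-constℕ q 1) (ℕ.*-identityˡ q)))))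
          q≡)

        g≤absent : ∀ i ℓ → g i ℓ ℕ.≤ absent L i ℓ
        g≤absent i ℓ = ℕ.+-cancelˡ-≤ (inRow L i ℓ) _ _
          (subst₂ ℕ._≤_ (inRow-top i ℓ) (sym (inRow+absent latin i ℓ)) (inRow≤1 M-latin (i ↑ˡ p) ℓ))

      routed : Routing (absent L) (λ _ → + n - + s) (demand n ρ e L leftover)
      routed = g , g≤absent , g-rows ,
        λ ℓ → trans (sym (pos-sum λ i → g i ℓ)) (sym (demand-leftover ℓ))

      demand-total : sumℤ (demand n ρ e L leftover) ≡ + r * (+ n - + s)
      demand-total = begin
        sumℤ (demand n ρ e L leftover)               ≡⟨ ℤΣ.sum-cong-≗ (proj₂ (proj₂ (proj₂ routed))) ⟨
        sumℤ (λ ℓ → sumℤ λ i → + g i ℓ)              ≡⟨ ℤΣ.∑-comm (λ ℓ i → + g i ℓ) ⟩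
        sumℤ (λ i → sumℤ λ ℓ → + g i ℓ)              ≡⟨ ℤΣ.sum-cong-≗ g-rows ⟩
        sumℤ {r} (λ i → + n - + s)                   ≡⟨ sum-const r _ ⟩
        + r * (+ n - + s)                            ∎
        where open ≡-Reasoning

      -- The copies below the old block are among the `w ℓ` copies in the new rows; those in the
      -- corner account for the difference.
      demands≤ : ∀ {y : Fin k → ℤ} → (∀ ℓ → y ℓ ≡ + sumℕ (λ j → rightCount s q r p (transpose M) j ℓ)) →
        ∀ ℓ → demand n ρ e L leftover ℓ + y ℓ ≤ + ρ ℓ - + e ℓ
      demands≤ {y} y≡ ℓ = subst₂ _≤_ (cong₂ _+_ (sym (demand-leftover ℓ)) (sym (y≡ ℓ)))
        (trans (shift (+ e ℓ) (+ x ℓ) (+ w ℓ)) (cong (_- + e ℓ) (sym (ρ≡ ℓ))))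
        (ℤ.+-monoʳ-≤ (+ x ℓ) (+≤+ (bottom-left≤ ℓ)))
        where
        shift : ∀ e x w → x + w ≡ e + x + w - e
        shift = solve-∀

  -- Fitting sequences and completability

  module _ {n k : ℕ} (ρ : Fin k → ℕ) {r s : ℕ} (r≤n : r ℕ.≤ n) (s≤n : s ℕ.≤ n)
           (L : Array r s k) (latin : IsLatin L) where
    private
      e : Fin k → ℕ
      e = occurrences L
      p q : ℕ
      p = n ℕ.∸ r
      q = n ℕ.∸ s

    R⇔ : ∀ a b → IsFitting n ρ L a b → ∀ i → R n ρ L a i ⇔ RowFeasible n ρ e L a
    R⇔ a b fitting = condition⇔Feasible n ρ e L a
      (Equivalence.to (demand-total⇔ n ρ e L a) (IsFitting.sum-a fitting)) (sum-absent latin)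

    C⇔ : ∀ a b → IsFitting n ρ L a b → ∀ i → C n ρ L b i ⇔ RowFeasible n ρ e (transpose L) b
    C⇔ a b fitting = condition⇔Feasible n ρ e (transpose L) b
      (Equivalence.to (demand-total⇔ n ρ e (transpose L) b) (IsFitting.sum-b fitting))
      λ ℓ → trans (sum-absent (IsLatin-transpose latin) ℓ) (cong (λ m → + s - + m) (occurrences-transpose L ℓ))

    private
      extension⇔ = completion⇔ (ℕ.m+[n∸m]≡n r≤n) (ℕ.m+[n∸m]≡n s≤n) r≤n s≤n ρ L
      p≡ : + p ≡ + n - + r
      p≡ = pos-∸ r≤n
      q≡ : + q ≡ + n - + s
      q≡ = pos-∸ s≤n

    fitting⇒completable : sumℕ ρ ≡ n ℕ.* n → ∀ a b → IsFitting n ρ L a b →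
      RowFeasible n ρ e L a → RowFeasible n ρ e (transpose L) b → Completable r≤n s≤n ρ L
    fitting⇒completable Σρ a b fitting feasibleʳ feasibleᶜ =
      let M , M-latin , extends , counts = Equivalence.to extension⇔
            (sufficient ρ (ℕ.m+[n∸m]≡n r≤n) (ℕ.m+[n∸m]≡n s≤n) L latin Σρ a b
              (Equivalence.to (demand-total⇔ n ρ e L a) (IsFitting.sum-a fitting))
              (Equivalence.to (demand-total⇔ n ρ e (transpose L) b) (IsFitting.sum-b fitting))
              demands≤ρ-e feasibleʳ feasibleᶜ)
      in M , record { isLatin = M-latin ; exact = counts } , extends
      where
      demands≤ρ-e : ∀ ℓ → demand n ρ e L a ℓ + demand n ρ e (transpose L) b ℓ ≤ + ρ ℓ - + e ℓ
      demands≤ρ-e ℓ = ≤-from-difference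
        (trans (cong (_- (+ a ℓ + + b ℓ)) (bound-excess n ρ e r s ℓ))
          (shift (+ ρ ℓ - + e ℓ) (+ a ℓ) (+ b ℓ) (excess n ρ e r ℓ) (excess n ρ e s ℓ)))
        (IsFitting.a+b≤ fitting ℓ)
        where
        shift : ∀ m a b x y → m - x - y - (a + b) ≡ m - (a + x + (b + y))
        shift = solve-∀

    completable⇒fitting : Completable r≤n s≤n ρ L → ∃₂ λ a b →
      IsFitting n ρ L a b × RowFeasible n ρ e L a × RowFeasible n ρ e (transpose L) b
    completable⇒fitting (M₀ , square , extends₀) = fit (Equivalence.from extension⇔
      (M₀ , IsLatinSquare.isLatin square , extends₀ , IsLatinSquare.exact square))
      where
      fit : Completion p q ρ L → ∃₂ λ a b →
        IsFitting n ρ L a b × RowFeasible n ρ e L a × RowFeasible n ρ e (transpose L) b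
      fit (M , M-latin , extends , counts) = Rows.leftover , Columns.leftover , fitting
        , routing⇒feasible (absent L) _ _ Rows.routed
        , routing⇒feasible (absent (transpose L)) _ _ Columns.routed
        where
        module Rows = Restriction.Counted r p s q M M-latin L extends
          ρ e counts (λ _ → refl) latin p≡ q≡
        module Columns = Restriction.Counted s q r p (transpose M) (IsLatin-transpose M-latin)
          (transpose L) (λ j i → extends i j)
          ρ e (λ ℓ → trans (occurrences-transpose M ℓ) (counts ℓ)) (λ ℓ → sym (occurrences-transpose L ℓ))
          (IsLatin-transpose latin) q≡ p≡
        a b : Fin k → ℕ
        a = Rows.leftover
        b = Columns.leftover

        fitting : IsFitting n ρ L a b
        fitting = record
          { sum-a = Equivalence.from (demand-total⇔ n ρ e L a) Rows.demand-total
          ; sum-b = Equivalence.from (demand-total⇔ n ρ e (transpose L) b) Columns.demand-total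
          ; a+b≤  = λ ℓ → subst (+ a ℓ + + b ℓ ≤_) (sym (bound-excess n ρ e r s ℓ))
              (≤-from-difference
                (shift (+ ρ ℓ - + e ℓ) (+ a ℓ) (+ b ℓ) (excess n ρ e r ℓ) (excess n ρ e s ℓ))
                (Rows.demands≤ {y = demand n ρ e (transpose L) b} Columns.demand-leftover ℓ))
          }
          where
          shift : ∀ m a b x y → m - (a + x + (b + y)) ≡ m - x - y - (a + b)
          shift = solve-∀

open import Data.Vec.Functional using (transpose)
open import Data.Fin.Patterns using (0F)
open import Function.Construct.Composition using (_⇔-∘_)
open import Function.Construct.Symmetry using (⇔-sym)
open import Data.Nat using (ℕ; _*_; _≤_; _<_; _⊓_)
open import Data.Fin using (Fin)
open import Data.Product using (_×_; ∃; ∃₂; _,_)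
open import Function.Bundles using (_⇔_; mk⇔; Equivalence)
open import Relation.Binary.PropositionalEquality using (_≡_)

theorem1p2 : ∀ (n k : ℕ) → 1 ≤ n → 1 ≤ k → n ≤ k →
    (ρ : Fin k → ℕ) → (∀ ℓ → 1 ≤ ρ ℓ × ρ ℓ ≤ n) → sumℕ ρ ≡ n * n →
    (r s : ℕ) (r≤n : r ≤ n) (s≤n : s ≤ n) → r ⊓ s < n →
    (L : Array r s k) → IsLatinRectangle ρ L →
    -- some condition of each list
    (Completable r≤n s≤n ρ L ⇔
      ∃₂ λ a b → IsFitting n ρ L a b × (∃ λ p → R n ρ L a p) × (∃ λ q → C n ρ L b q))
    ×
    -- every condition of each list
    (Completable r≤n s≤n ρ L ⇔
      ∃₂ λ a b → IsFitting n ρ L a b × (∀ p → R n ρ L a p) × (∀ q → C n ρ L b q))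
    ×
    (∀ a b → IsFitting n ρ L a b →
      (∀ p q → R n ρ L a p ⇔ R n ρ L a q) × (∀ p q → C n ρ L b p ⇔ C n ρ L b q))
theorem1p2 n k _ _ _ ρ _ Σρ r s r≤n s≤n _ L rectangle =
    -- Both equivalences are read off from the cycle completable, `Every`, `Some`, completable.
    mk⇔ (λ completable → weaken (every completable)) some
  , mk⇔ every (λ conditions → some (weaken conditions))
  , λ a b fit →
      (λ p q → ⇔-sym (rows a b fit q) ⇔-∘ rows a b fit p)
    , (λ p q → ⇔-sym (columns a b fit q) ⇔-∘ columns a b fit p)
  where
  latin = IsLatinRectangle.isLatin rectangle
  rows = R⇔ ρ r≤n s≤n L latin
  columns = C⇔ ρ r≤n s≤n L latin

  Some Every : Set
  Some  = ∃₂ λ a b → IsFitting n ρ L a b × (∃ λ p → R n ρ L a p) × (∃ λ q → C n ρ L b q)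
  Every = ∃₂ λ a b → IsFitting n ρ L a b × (∀ p → R n ρ L a p) × (∀ q → C n ρ L b q)

  weaken : Every → Some
  weaken (a , b , fit , Rs , Cs) = a , b , fit , (0F , Rs 0F) , (0F , Cs 0F)

  some : Some → Completable r≤n s≤n ρ L
  some (a , b , fit , (p , Rp) , (q , Cq)) = fitting⇒completable ρ r≤n s≤n L latin Σρ a b fit
    (Equivalence.to (rows a b fit p) Rp) (Equivalence.to (columns a b fit q) Cq)

  every : Completable r≤n s≤n ρ L → Every
  every completable = conditions (completable⇒fitting ρ r≤n s≤n L latin completable)
    where
    conditions :
      (∃₂ λ a b → IsFitting n ρ L a b × RowFeasible n ρ (occurrences L) L a
        × RowFeasible n ρ (occurrences L) (transpose L) b) → Every
    conditions (a , b , fit , feasibleʳ , feasibleᶜ) = a , b , fit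
      , (λ p → Equivalence.from (rows a b fit p) feasibleʳ)
      , (λ q → Equivalence.from (columns a b fit q) feasibleᶜ)
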